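{- Let $\beta$ be a Salem number of degree six with minimal polynomial $P(x)$. Then $\beta \in P_{1,7} \cap C_{x^2-x+1}$ (that is, $d_\beta(1)$ is eventually periodic with preperiod length $1$ and period length $7$, and the co-factor of $\beta$ is $x^2-x+1$) if and only if $P(x)$ is one of the following three polynomials: $$x^6 - x^4 - x^3 - x^2 + 1,\qquad x^6 - x^4 - 2x^3 - x^2 + 1,\qquad x^6 - 2x^4 - 3x^3 - 2x^2 + 1.$$
   Context: A Salem number is a real algebraic integer $\beta>1$ whose other Galois conjugates all satisfy $|\alpha|\le 1$, with at least one satisfying $|\alpha|=1$. For real $\beta>1$, the greedy beta expansion $d_\beta(1)=(c_n)_{n\ge1}$ is defined by $r_0=1$, and for $n\ge 1$: $c_n=\lfloor \beta r_{n-1}\rfloor$, $r_n=\beta r_{n-1}-\lfloor \beta r_{n-1}\rfloor$. If it is eventually periodic, $\beta$ is called a Parry number, and the smallest $m\ge0$ and $p\ge1$ with $c_{n+m}=c_{n+m+p}$ for all $n\ge1$ are the preperiod length and the period length of the expansion. (By convention $p=0$ if $r_N=0$ for some $N$; this never happens for Salem numbers.) For a Salem number $\beta$ that is a Parry number with preperiod length $m$ and period length $p\geq 1$, put $P_k(x)=x^k-c_1x^{k-1}-\dots-c_k$. The companion polynomial is $R(x)=P_{m+p}(x)-P_m(x)$; it has $\beta$ as a root, so $R(x)=P(x)Q(x)$ with $P$ the minimal polynomial of $\beta$ and $Q\in\mathbb{Z}[x]$; $Q$ is the co-factor of $\beta$. $P_{m,p}$ denotes the set of Salem Parry numbers whose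 beta expansion $d_\beta(1)$ has preperiod length $m$ and period length $p$. $C_{Q(x)}$ denotes the set of all Salem (Parry) numbers whose co-factor is $Q(x)$. -}

module Defs where

open import Level using (0ℓ)
open import Algebra.Bundles using (RawRing)
open import Data.Nat.Base as ℕ using (ℕ; zero; suc; _⊔_)
import Data.Nat.Properties as ℕ
open import Data.Integer.Base as ℤ using (ℤ; +_)
open import Data.Rational.Base as ℚ using (ℚ; 0ℚ; 1ℚ; ½; ∣_∣; _+_; _*_; _-_; -_; _<_)
import Data.Rational.Properties as ℚ
open import Data.Rational.Solver using (module +-*-Solver)
open import Data.List.Base using (List; []; _∷_; map)
open import Data.Product.Base using (_×_; _,_; ∃-syntax; Σ-syntax)
open import Function.Base using (_∘_)
open import Relation.Nullary.Negation.Core using (¬_)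
open import Relation.Binary.PropositionalEquality
  using (_≡_; refl; sym; trans; cong; cong₂; subst)

Cauchy : (ℕ → ℚ) → Set
Cauchy f = ∀ ε → 0ℚ < ε → ∃[ N ] (∀ m n → N ℕ.≤ m → N ℕ.≤ n → ∣ f m - f n ∣ < ε)

record ℝ : Set where
  constructor mkℝ
  field
    seq    : ℕ → ℚ
    cauchy : Cauchy seq

open ℝ public

infix 4 _≈ᵣ_ _<ᵣ_ _≤ᵣ_

_≈ᵣ_ : ℝ → ℝ → Set
x ≈ᵣ y = ∀ ε → 0ℚ < ε → ∃[ N ] (∀ n → N ℕ.≤ n → ∣ seq x n - seq y n ∣ < ε)

_<ᵣ_ : ℝ → ℝ → Set
x <ᵣ y = ∃[ ε ] (0ℚ < ε × ∃[ N ] (∀ n → N ℕ.≤ n → seq x n + ε < seq y n))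

_≤ᵣ_ : ℝ → ℝ → Set
x ≤ᵣ y = ¬ (y <ᵣ x)

private
  half>0 : ∀ {ε} → 0ℚ < ε → 0ℚ < ½ * ε
  half>0 {ε} ε>0 = subst (_< ½ * ε) (ℚ.*-zeroʳ ½) (ℚ.*-monoʳ-<-pos ½ ε>0)

  half+half : ∀ ε → ½ * ε + ½ * ε ≡ ε
  half+half ε = trans (sym (ℚ.*-distribʳ-+ ε ½ ½)) (ℚ.*-identityˡ ε)

  +-cauchy : ∀ {f g} → Cauchy f → Cauchy g → Cauchy (λ n → f n + g n)
  +-cauchy {f} {g} F G ε ε>0 with F (½ * ε) (half>0 {ε} ε>0) | G (½ * ε) (half>0 {ε} ε>0)
  ... | M , F′ | N , G′ = M ⊔ N , λ m n m≥ n≥ →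
    let open ℚ.≤-Reasoning in begin-strict
      ∣ (f m + g m) - (f n + g n) ∣
        ≡⟨ cong ∣_∣ (solve 4 (λ a b c d → (a :+ b) :- (c :+ d) := (a :- c) :+ (b :- d))
                      refl (f m) (g m) (f n) (g n)) ⟩
      ∣ (f m - f n) + (g m - g n) ∣
        ≤⟨ ℚ.∣p+q∣≤∣p∣+∣q∣ (f m - f n) (g m - g n) ⟩
      ∣ f m - f n ∣ + ∣ g m - g n ∣
        <⟨ ℚ.+-mono-< (F′ m n (ℕ.m⊔n≤o⇒m≤o M N m≥) (ℕ.m⊔n≤o⇒m≤o M N n≥))
                      (G′ m n (ℕ.m⊔n≤o⇒n≤o M N m≥) (ℕ.m⊔n≤o⇒n≤o M N n≥)) ⟩
      ½ * ε + ½ * ε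
        ≡⟨ half+half ε ⟩
      ε ∎
    where open +-*-Solver

  neg-cauchy : ∀ {f} → Cauchy f → Cauchy (λ n → - f n)
  neg-cauchy {f} F ε ε>0 with F ε ε>0
  ... | N , F′ = N , λ m n m≥ n≥ → subst (_< ε) (eq m n) (F′ m n m≥ n≥)
    where
    open +-*-Solver
    eq : ∀ m n → ∣ f m - f n ∣ ≡ ∣ - f m - (- f n) ∣
    eq m n = trans (sym (ℚ.∣-p∣≡∣p∣ (f m - f n)))
      (cong ∣_∣ (solve 2 (λ a b → :- (a :- b) := :- a :- (:- b)) refl (f m) (f n)))

  0<1 : 0ℚ < 1ℚ
  0<1 = ℚ.positive⁻¹ 1ℚ

  EventuallyBounded : (ℕ → ℚ) → Set
  EventuallyBounded f = ∃[ B ] (0ℚ < B × ∃[ N ] (∀ n → N ℕ.≤ n → ∣ f n ∣ < B))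

  bounded : ∀ {f} → Cauchy f → EventuallyBounded f
  bounded {f} F with F 1ℚ 0<1
  ... | N , F′ = 1ℚ + ∣ f N ∣ , ℚ.+-mono-<-≤ 0<1 (ℚ.0≤∣p∣ (f N)) , N , λ n n≥ →
    let open ℚ.≤-Reasoning in begin-strict
      ∣ f n ∣                   ≡⟨ cong ∣_∣ (solve 2 (λ a b → a := (a :- b) :+ b) refl (f n) (f N)) ⟩
      ∣ (f n - f N) + f N ∣     ≤⟨ ℚ.∣p+q∣≤∣p∣+∣q∣ (f n - f N) (f N) ⟩
      ∣ f n - f N ∣ + ∣ f N ∣   <⟨ ℚ.+-monoˡ-< ∣ f N ∣ (F′ n N n≥ ℕ.≤-refl) ⟩
      1ℚ + ∣ f N ∣              ∎
    where open +-*-Solver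

  *-small : ∀ {a b B : ℚ} (δ : ℚ) → 0ℚ < B → 0ℚ < δ → ∣ a ∣ < B → ∣ b ∣ < δ → ∣ a * b ∣ < B * δ
  *-small {a} {b} {B} δ B>0 δ>0 a<B b<δ = begin-strict
    ∣ a * b ∣      ≡⟨ ℚ.∣p*q∣≡∣p∣*∣q∣ a b ⟩
    ∣ a ∣ * ∣ b ∣  ≤⟨ ℚ.*-monoʳ-≤-nonNeg ∣ b ∣ {{ℚ.∣-∣-nonNeg b}} (ℚ.<⇒≤ a<B) ⟩
    B * ∣ b ∣      <⟨ ℚ.*-monoʳ-<-pos B {{ℚ.positive B>0}} b<δ ⟩
    B * δ          ∎
    where open ℚ.≤-Reasoning

  divide : ∀ {ε B} → 0ℚ < ε → 0ℚ < B → ∃[ δ ] (0ℚ < δ × B * δ ≡ ε)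
  divide {ε} {B} ε>0 B>0 = (1/B * ε) , pos , eq
    where
    instance
      B+ = ℚ.positive B>0
      B≠ = ℚ.pos⇒nonZero B
    1/B = ℚ.1/ B
    pos : 0ℚ < 1/B * ε
    pos = ℚ.positive⁻¹ _ {{ℚ.pos*pos⇒pos 1/B {{ℚ.1/pos⇒pos B}} ε {{ℚ.positive ε>0}}}}
    eq : B * (1/B * ε) ≡ ε
    eq = trans (sym (ℚ.*-assoc B 1/B ε))
           (trans (cong (_* ε) (ℚ.*-inverseʳ B)) (ℚ.*-identityˡ ε))

  *-difference : ∀ a b c d → a * b - c * d ≡ a * (b - d) + d * (a - c)
  *-difference = solve 4 (λ a b c d → a :* b :- c :* d := a :* (b :- d) :+ d :* (a :- c)) refl
    where open +-*-Solver

  *-close : ∀ {f g : ℕ → ℚ} {A B α β ε : ℚ} → 0ℚ < A → 0ℚ < B → 0ℚ < α → 0ℚ < β →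
            A * α ≡ ½ * ε → B * β ≡ ½ * ε → ∀ (m n : ℕ) →
            ∣ f m ∣ < A → ∣ g n ∣ < B → ∣ g m - g n ∣ < α → ∣ f m - f n ∣ < β →
            ∣ f m * g m - f n * g n ∣ < ε
  *-close {f} {g} {A} {B} {α} {β} {ε} A>0 B>0 α>0 β>0 Aα Bβ m n fm gn gmn fmn = begin-strict
    ∣ f m * g m - f n * g n ∣
      ≡⟨ cong ∣_∣ (*-difference (f m) (g m) (f n) (g n)) ⟩
    ∣ f m * (g m - g n) + g n * (f m - f n) ∣
      ≤⟨ ℚ.∣p+q∣≤∣p∣+∣q∣ (f m * (g m - g n)) (g n * (f m - f n)) ⟩
    ∣ f m * (g m - g n) ∣ + ∣ g n * (f m - f n) ∣
      <⟨ ℚ.+-mono-< (*-small {f m} {g m - g n} {A} α A>0 α>0 fm gmn)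
                    (*-small {g n} {f m - f n} {B} β B>0 β>0 gn fmn) ⟩
    A * α + B * β
      ≡⟨ cong₂ _+_ Aα Bβ ⟩
    ½ * ε + ½ * ε
      ≡⟨ half+half ε ⟩
    ε ∎
    where open ℚ.≤-Reasoning

  *-cauchy : ∀ {f g} → Cauchy f → Cauchy g → Cauchy (λ n → f n * g n)
  *-cauchy {f} {g} F G ε ε>0 = choose (bounded {f} F) (bounded {g} G)
    where
    Goal : Set
    Goal = ∃[ N ] (∀ m n → N ℕ.≤ m → N ℕ.≤ n → ∣ f m * g m - f n * g n ∣ < ε)

    choose : EventuallyBounded f → EventuallyBounded g → Goal
    choose (A , A>0 , K , fb) (B , B>0 , L , gb) =
      finish (divide {½ * ε} {A} (half>0 {ε} ε>0) A>0) (divide {½ * ε} {B} (half>0 {ε} ε>0) B>0)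
      where
      finish : ∃[ α ] (0ℚ < α × A * α ≡ ½ * ε) → ∃[ β ] (0ℚ < β × B * β ≡ ½ * ε) → Goal
      finish (α , α>0 , Aα) (β , β>0 , Bβ) = combine (G α α>0) (F β β>0)
        where
        combine : ∃[ M ] (∀ m n → M ℕ.≤ m → M ℕ.≤ n → ∣ g m - g n ∣ < α) →
                  ∃[ N ] (∀ m n → N ℕ.≤ m → N ℕ.≤ n → ∣ f m - f n ∣ < β) → Goal
        combine (M , G′) (N , F′) = (K ⊔ L) ⊔ (M ⊔ N) , λ m n m≥ n≥ →
          let m≥K⊔L = ℕ.m⊔n≤o⇒m≤o (K ⊔ L) (M ⊔ N) m≥
              n≥K⊔L = ℕ.m⊔n≤o⇒m≤o (K ⊔ L) (M ⊔ N) n≥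
              m≥M⊔N = ℕ.m⊔n≤o⇒n≤o (K ⊔ L) (M ⊔ N) m≥
              n≥M⊔N = ℕ.m⊔n≤o⇒n≤o (K ⊔ L) (M ⊔ N) n≥
          in *-close {f} {g} {A} {B} {α} {β} {ε} A>0 B>0 α>0 β>0 Aα Bβ m n
               (fb m (ℕ.m⊔n≤o⇒m≤o K L m≥K⊔L))
               (gb n (ℕ.m⊔n≤o⇒n≤o K L n≥K⊔L))
               (G′ m n (ℕ.m⊔n≤o⇒m≤o M N m≥M⊔N) (ℕ.m⊔n≤o⇒m≤o M N n≥M⊔N))
               (F′ m n (ℕ.m⊔n≤o⇒n≤o M N m≥M⊔N) (ℕ.m⊔n≤o⇒n≤o M N n≥M⊔N))

infixl 6 _+ᵣ_ _-ᵣ_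
infixl 7 _*ᵣ_
infix  8 -ᵣ_

ℚ⇒ℝ : ℚ → ℝ
ℚ⇒ℝ q = mkℝ (λ _ → q) λ ε ε>0 → 0 , λ _ _ _ _ →
  subst (_< ε) (cong ∣_∣ (sym (ℚ.+-inverseʳ q))) ε>0

_+ᵣ_ _*ᵣ_ : ℝ → ℝ → ℝ
x +ᵣ y = mkℝ (λ n → seq x n + seq y n) (+-cauchy {seq x} {seq y} (cauchy x) (cauchy y))
x *ᵣ y = mkℝ (λ n → seq x n * seq y n) (*-cauchy {seq x} {seq y} (cauchy x) (cauchy y))

-ᵣ_ : ℝ → ℝ
-ᵣ x = mkℝ (λ n → - seq x n) (neg-cauchy {seq x} (cauchy x))

_-ᵣ_ : ℝ → ℝ → ℝ
x -ᵣ y = x +ᵣ (-ᵣ y)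

ℤ⇒ℚ : ℤ → ℚ
ℤ⇒ℚ k = k ℚ./ 1

ℤ⇒ℝ : ℤ → ℝ
ℤ⇒ℝ = ℚ⇒ℝ ∘ ℤ⇒ℚ

0ᵣ 1ᵣ : ℝ
0ᵣ = ℚ⇒ℝ 0ℚ
1ᵣ = ℚ⇒ℝ 1ℚ

ℝ-rawRing : RawRing 0ℓ 0ℓ
ℝ-rawRing = record
  { Carrier = ℝ ; _≈_ = _≈ᵣ_ ; _+_ = _+ᵣ_ ; _*_ = _*ᵣ_ ; -_ = -ᵣ_ ; 0# = 0ᵣ ; 1# = 1ᵣ }

record ℂ : Set where
  constructor _+i_
  field
    re im : ℝ

open ℂ public

ℂ-rawRing : RawRing 0ℓ 0ℓ
ℂ-rawRing = record
  { Carrier = ℂ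
  ; _≈_     = λ z w → re z ≈ᵣ re w × im z ≈ᵣ im w
  ; _+_     = λ z w → (re z +ᵣ re w) +i (im z +ᵣ im w)
  ; _*_     = λ z w → (re z *ᵣ re w -ᵣ im z *ᵣ im w) +i (re z *ᵣ im w +ᵣ im z *ᵣ re w)
  ; -_      = λ z → (-ᵣ re z) +i (-ᵣ im z)
  ; 0#      = 0ᵣ +i 0ᵣ
  ; 1#      = 1ᵣ +i 0ᵣ
  }

infix 4 _≈ᶜ_

_≈ᶜ_ : ℂ → ℂ → Set
_≈ᶜ_ = RawRing._≈_ ℂ-rawRing

ℝ⇒ℂ : ℝ → ℂ
ℝ⇒ℂ x = x +i 0ᵣ

-- The square of the modulus; |z| ≤ 1 and |z| = 1 are expressed below as
-- |z|² ≤ 1 and |z|² = 1, which avoids constructing square roots.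
∣_∣² : ℂ → ℝ
∣ z ∣² = re z *ᵣ re z +ᵣ im z *ᵣ im z

-- Polynomials are lists of coefficients with the constant coefficient first.
-- Trailing zeros are allowed, so polynomials are compared with _≈ₚ_, not _≡_.

module Polynomial (R : RawRing 0ℓ 0ℓ) where
  open RawRing R
    using (Carrier; _≈_; 0#; 1#)
    renaming (_+_ to _+ʳ_; _*_ to _*ʳ_; -_ to -ʳ_)

  Poly : Set
  Poly = List Carrier

  coeff : Poly → ℕ → Carrier
  coeff []      _       = 0#
  coeff (a ∷ p) zero    = a
  coeff (a ∷ p) (suc i) = coeff p i

  infix  4 _≈ₚ_
  infixl 6 _+ₚ_ _-ₚ_
  infixl 7 _*ₚ_

  _≈ₚ_ : Poly → Poly → Set
  p ≈ₚ q = ∀ i → coeff p i ≈ coeff q i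

  _+ₚ_ _-ₚ_ _*ₚ_ : Poly → Poly → Poly
  []      +ₚ q       = q
  (a ∷ p) +ₚ []      = a ∷ p
  (a ∷ p) +ₚ (b ∷ q) = (a +ʳ b) ∷ (p +ₚ q)

  p -ₚ q = p +ₚ map -ʳ_ q

  []      *ₚ q = []
  (a ∷ p) *ₚ q = map (a *ʳ_) q +ₚ (0# ∷ p *ₚ q)

  HasDegree : Poly → ℕ → Set
  HasDegree p d = ¬ (coeff p d ≈ 0#) × (∀ i → d ℕ.< i → coeff p i ≈ 0#)

  Monic : Poly → Set
  Monic p = ∃[ d ] (HasDegree p d × coeff p d ≈ 1#)

open Polynomial ℚ.+-*-rawRing public
  renaming (Poly to ℚ[x])
module ℤ[x] = Polynomial ℤ.+-*-rawRing
open ℤ[x] public using () renaming (Poly to ℤ[x])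

ℤ[x]⇒ℚ[x] : ℤ[x] → ℚ[x]
ℤ[x]⇒ℚ[x] = map ℤ⇒ℚ

evalIn : (S : RawRing 0ℓ 0ℓ) → (ℚ → RawRing.Carrier S) →
         ℚ[x] → RawRing.Carrier S → RawRing.Carrier S
evalIn S ι []      s = RawRing.0# S
evalIn S ι (a ∷ p) s = ι a +ˢ s *ˢ evalIn S ι p s
  where open RawRing S renaming (_+_ to _+ˢ_; _*_ to _*ˢ_)

evalᵣ : ℚ[x] → ℝ → ℝ
evalᵣ = evalIn ℝ-rawRing ℚ⇒ℝ

evalᶜ : ℚ[x] → ℂ → ℂ
evalᶜ = evalIn ℂ-rawRing (ℝ⇒ℂ ∘ ℚ⇒ℝ)

AlgebraicInteger : ℝ → Set
AlgebraicInteger β =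
  Σ[ F ∈ ℤ[x] ] (ℤ[x].Monic F × evalᵣ (ℤ[x]⇒ℚ[x] F) β ≈ᵣ 0ᵣ)

record IsMinimalPolynomial (β : ℝ) (P : ℚ[x]) : Set where
  field
    monic   : Monic P
    root    : evalᵣ P β ≈ᵣ 0ᵣ
    minimal : ∀ F d e → HasDegree P d → HasDegree F e → evalᵣ F β ≈ᵣ 0ᵣ → d ℕ.≤ e

GaloisConjugate : ℝ → ℂ → Set
GaloisConjugate β α =
  Σ[ P ∈ ℚ[x] ] (IsMinimalPolynomial β P × evalᶜ P α ≈ᶜ ℝ⇒ℂ 0ᵣ)

OtherGaloisConjugate : ℝ → ℂ → Set
OtherGaloisConjugate β α = GaloisConjugate β α × ¬ (α ≈ᶜ ℝ⇒ℂ β)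

record IsSalem (β : ℝ) : Set where
  field
    algebraicInteger : AlgebraicInteger β
    β>1              : 1ᵣ <ᵣ β
    conjugates≤1     : ∀ α → OtherGaloisConjugate β α → ∣ α ∣² ≤ᵣ 1ᵣ
    conjugate≡1      : Σ[ α ∈ ℂ ] (OtherGaloisConjugate β α × ∣ α ∣² ≈ᵣ 1ᵣ)

IsFloor : ℝ → ℤ → Set
IsFloor x k = ℤ⇒ℝ k ≤ᵣ x × x <ᵣ ℤ⇒ℝ k +ᵣ 1ᵣ

-- The floor function on ℝ is not computable, so the expansion is given as a
-- relation; it determines the digits c n for n ≥ 1 uniquely.  The value c 0 is
-- arbitrary and is not used anywhere.
record IsGreedyExpansion (β : ℝ) (c : ℕ → ℤ) : Set where
  field
    r     : ℕ → ℝ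
    r₀    : r 0 ≈ᵣ 1ᵣ
    digit : ∀ n → IsFloor (β *ᵣ r n) (c (suc n))
    step  : ∀ n → r (suc n) ≈ᵣ β *ᵣ r n -ᵣ ℤ⇒ℝ (c (suc n))

EventuallyPeriodic : (ℕ → ℤ) → ℕ → ℕ → Set
EventuallyPeriodic c m p = ∀ n → 1 ℕ.≤ n → c (n ℕ.+ m) ≡ c (n ℕ.+ m ℕ.+ p)

-- Only periods p ≥ 1 are covered: the convention p = 0 for expansions with a
-- zero remainder never applies to Salem numbers.
record HasPreperiodAndPeriod (c : ℕ → ℤ) (m p : ℕ) : Set where
  field
    p≥1      : 1 ℕ.≤ p
    periodic : EventuallyPeriodic c m p
    least    : ∀ m′ p′ → 1 ℕ.≤ p′ → EventuallyPeriodic c m′ p′ → m ℕ.≤ m′ × p ℕ.≤ p′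

-- Pₖ = xᵏ - c₁xᵏ⁻¹ - … - cₖ, via Pₖ₊₁ = x Pₖ - cₖ₊₁.
Pₖ : (ℕ → ℤ) → ℕ → ℤ[x]
Pₖ c zero    = + 1 ∷ []
Pₖ c (suc k) = ℤ.- c (suc k) ∷ Pₖ c k

companion : (ℕ → ℤ) → ℕ → ℕ → ℤ[x]
companion c m p = Pₖ c (m ℕ.+ p) ℤ[x].-ₚ Pₖ c m

SalemParry : ℕ → ℕ → ℝ → Set
SalemParry m p β = IsSalem β ×
  Σ[ c ∈ (ℕ → ℤ) ] (IsGreedyExpansion β c × HasPreperiodAndPeriod c m p)

IsCofactor : ℝ → ℤ[x] → Set
IsCofactor β Q =
  Σ[ c ∈ (ℕ → ℤ) ] ∃[ m ] ∃[ p ] Σ[ P ∈ ℚ[x] ]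
    ( IsGreedyExpansion β c
    × HasPreperiodAndPeriod c m p
    × IsMinimalPolynomial β P
    × ℤ[x]⇒ℚ[x] (companion c m p) ≈ₚ P *ₚ ℤ[x]⇒ℚ[x] Q )

SalemWithCofactor : ℤ[x] → ℝ → Set
SalemWithCofactor Q β = IsSalem β × IsCofactor β Q

{-# OPTIONS --safe #-}
module Submission where

-- If the co-factor is x² - x + 1, the factorisation P₈ - P₁ = P · (x² - x + 1)
-- expresses the digits c₁, …, c₈ by the coefficients of P.  A Salem polynomial
-- is palindromic, since P and its reversal share a conjugate on the unit
-- circle; hence the digits are c₁, c₂, c₃, c₄, c₃, c₂, c₁ - 1, c₁ - 1 with
-- c₄ + c₃ + 1 = 2 c₁ + c₂.  The Parry conditions cₙ ≤ c₁, and cₙ₊₁ ≤ c₂ whenever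
-- cₙ = c₁, leave c₁ = 1 and three choices of (c₂, c₃).  Conversely the expansion
-- is known in advance: rₙ = β rₙ₋₁ - cₙ satisfies r₈ = r₁, and 0 ≤ rₙ < 1 follows
-- from a lexicographic comparison of the digits, using β > 1 only.

open import Defs
open import Algebra.Bundles using (CommutativeRing; RawRing)
import Algebra.Properties.Semiring.Exp as Exp
import Algebra.Solver.Ring.NaturalCoefficients.Default as SemiringSolver
open import Data.Empty using (⊥)
open import Data.Integer.Base as ℤ using (ℤ; 0ℤ; 1ℤ; -1ℤ; -[1+_])
import Data.Integer.Properties as ℤ
import Data.Integer.Solver as ℤ
open import Data.List.Base using ([]; _∷_; map; length; reverse; applyUpTo; _++_)
open import Data.List.Properties using (unfold-reverse; length-reverse; length-applyUpTo)
open import Data.Nat.Base as ℕ using (ℕ; zero; suc; _⊔_; z≤n; s≤s)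
open import Data.Nat.Induction using (<-rec)
import Data.Nat.Properties as ℕ
import Data.Nat.Solver as ℕ
open import Data.Product.Base using (_×_; _,_; ∃-syntax; proj₁; proj₂)
open import Data.Rational.Base as ℚ using (ℚ; 0ℚ; 1ℚ; ½; ∣_∣; _+_; _*_; _-_; -_; _<_; _≤_)
import Data.Rational.Properties as ℚ
open import Data.Rational.Solver using (module +-*-Solver)
open import Data.Rational.Unnormalised.Base as ℚᵘ using (mkℚᵘ; *≡*; *≤*)
import Data.Rational.Unnormalised.Properties as ℚᵘ
open import Data.Sum.Base using (_⊎_; inj₁; inj₂; [_,_]′)
open import Function.Base using (_∘_)
open import Function.Bundles using (_⇔_; mk⇔)
open import Level using (0ℓ)
open import Relation.Binary.PropositionalEquality
  using (_≡_; refl; sym; trans; cong; cong₂; subst; subst₂; module ≡-Reasoning)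
open import Relation.Nullary using (¬_; yes; no; contradiction)

open +-*-Solver
open ℕ.+-*-Solver using () renaming
  (solve to ℕ-solve; con to conⁿ; _:+_ to _:+ⁿ_; _:*_ to _:*ⁿ_; _:=_ to _:=ⁿ_)
open ℤ.+-*-Solver using () renaming
  (solve to ℤ-solve; con to conᶻ; _:+_ to _:+ᶻ_; _:-_ to _:-ᶻ_; _:=_ to _:=ᶻ_)

-- Rational and integer preliminaries

-- Two obstacles shape the proof. The order on `ℝ` cannot be decided: strict inequalities are
-- handled as positivity with a rational margin, weak ones as negations, and `Pos-split` replaces
-- case distinctions. Moreover, minimality of `P` is stated at β only, while palindromicity needs it
-- at a conjugate α. Euclid's algorithm over ℚ transfers it: no nonzero polynomial of degree below
-- that of `P` vanishes at α. Applied to the reversal of `P` minus p₀ P, this gives p₆₋ᵢ = p₀ pᵢ,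
-- hence p₀ = 1 or p₀ = -1, and p₀ = c₁ - c₈ ≥ 0 settles the sign. The relation among c₁, ..., c₄
-- exists because a monic palindromic sextic has only three free coefficients. The factorisation
-- hypothesis brings its own expansion, preperiod, period and minimal polynomial, so the uniqueness
-- of each of them enters.

p<q⇒0<q-p : ∀ {p q} → p < q → 0ℚ < q - p
p<q⇒0<q-p {p} {q} p<q = subst (_< q - p) (ℚ.+-inverseʳ p) (ℚ.+-monoˡ-< (- p) p<q)

0<q-p⇒p<q : ∀ {p q} → 0ℚ < q - p → p < q
0<q-p⇒p<q {p} {q} 0<q-p = subst₂ _<_ (ℚ.+-identityˡ p)
  (solve 2 (λ q p → q :- p :+ p := q) refl q p) (ℚ.+-monoˡ-< p 0<q-p)

-- Certificates for linear inequalities: p < q because q - p is the sum of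
-- the slacks of the given inequalities.

linear₁ : ∀ {p q a b} → a < b → b - a ≡ q - p → p < q
linear₁ a<b eq = 0<q-p⇒p<q (subst (0ℚ <_) eq (p<q⇒0<q-p a<b))

linear₂ : ∀ {p q a b c d} → a < b → c < d → (b - a) + (d - c) ≡ q - p → p < q
linear₂ a<b c<d eq =
  0<q-p⇒p<q (subst (0ℚ <_) eq (ℚ.+-mono-< (p<q⇒0<q-p a<b) (p<q⇒0<q-p c<d)))

p≤∣p∣ : ∀ p → p ≤ ∣ p ∣
p≤∣p∣ p with ℚ.≤-total 0ℚ p
... | inj₁ 0≤p = ℚ.≤-reflexive (sym (ℚ.0≤p⇒∣p∣≡p 0≤p))
... | inj₂ p≤0 = ℚ.≤-trans p≤0 (ℚ.0≤∣p∣ p)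

∣p∣<q⇒p<q : ∀ {p q} → ∣ p ∣ < q → p < q
∣p∣<q⇒p<q {p} = ℚ.≤-<-trans (p≤∣p∣ p)

∣p∣<q⇒-p<q : ∀ {p q} → ∣ p ∣ < q → - p < q
∣p∣<q⇒-p<q {p} {q} ∣p∣<q = ∣p∣<q⇒p<q (subst (_< q) (sym (ℚ.∣-p∣≡∣p∣ p)) ∣p∣<q)

p<q×-p<q⇒∣p∣<q : ∀ {p q} → p < q → - p < q → ∣ p ∣ < q
p<q×-p<q⇒∣p∣<q {p} {q} p<q -p<q with ℚ.∣p∣≡p∨∣p∣≡-p p
... | inj₁ eq = subst (_< q) (sym eq) p<q
... | inj₂ eq = subst (_< q) (sym eq) -p<q

halve : ∀ {ε} → 0ℚ < ε → ∃[ δ ] (0ℚ < δ × δ + δ ≡ ε)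
halve {ε} ε>0 = ½ * ε
  , subst (_< ½ * ε) (ℚ.*-zeroʳ ½) (ℚ.*-monoʳ-<-pos ½ ε>0)
  , trans (sym (ℚ.*-distribʳ-+ ε ½ ½)) (ℚ.*-identityˡ ε)

divide : ∀ {ε B} → 0ℚ < ε → 0ℚ < B → ∃[ δ ] (0ℚ < δ × B * δ ≡ ε)
divide {ε} {B} ε>0 B>0 = ℚ.1/ B * ε
  , ℚ.positive⁻¹ _ {{ℚ.pos*pos⇒pos (ℚ.1/ B) {{ℚ.1/pos⇒pos B}} ε {{ℚ.positive ε>0}}}}
  , trans (sym (ℚ.*-assoc B (ℚ.1/ B) ε))
      (trans (cong (_* ε) (ℚ.*-inverseʳ B)) (ℚ.*-identityˡ ε))
  where
  instance
    B+ = ℚ.positive B>0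
    B≠0 = ℚ.pos⇒nonZero B

0<p*q : ∀ {p q} → 0ℚ < p → 0ℚ < q → 0ℚ < p * q
0<p*q {p} {q} p>0 q>0 =
  ℚ.positive⁻¹ _ {{ℚ.pos*pos⇒pos p {{ℚ.positive p>0}} q {{ℚ.positive q>0}}}}

0<1 : 0ℚ < 1ℚ
0<1 = ℚ.positive⁻¹ 1ℚ

-- `k / 1` is normalised by a gcd, which does not compute for a variable `k`. Arithmetic and order
-- of `ℤ⇒ℚ` are therefore checked on unnormalised fractions, where the second argument 0 of `mkℚᵘ`
-- means denominator 1.
toℚᵘ-ℤ⇒ℚ : ∀ k → ℚ.toℚᵘ (ℤ⇒ℚ k) ℚᵘ.≃ mkℚᵘ k 0
toℚᵘ-ℤ⇒ℚ k = ℚ.toℚᵘ-fromℚᵘ (mkℚᵘ k 0)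

ℤ⇒ℚ-homo-+ : ∀ k l → ℤ⇒ℚ (k ℤ.+ l) ≡ ℤ⇒ℚ k + ℤ⇒ℚ l
ℤ⇒ℚ-homo-+ k l = ℚ.toℚᵘ-injective (begin
  ℚ.toℚᵘ (ℤ⇒ℚ (k ℤ.+ l))                  ≈⟨ toℚᵘ-ℤ⇒ℚ (k ℤ.+ l) ⟩
  mkℚᵘ (k ℤ.+ l) 0                        ≈⟨ *≡* (cong (ℤ._* 1ℤ)
    (cong₂ ℤ._+_ (sym (ℤ.*-identityʳ k)) (sym (ℤ.*-identityʳ l)))) ⟩
  mkℚᵘ k 0 ℚᵘ.+ mkℚᵘ l 0                  ≈⟨ ℚᵘ.+-cong (toℚᵘ-ℤ⇒ℚ k) (toℚᵘ-ℤ⇒ℚ l) ⟨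
  ℚ.toℚᵘ (ℤ⇒ℚ k) ℚᵘ.+ ℚ.toℚᵘ (ℤ⇒ℚ l)      ≈⟨ ℚ.toℚᵘ-homo-+ (ℤ⇒ℚ k) (ℤ⇒ℚ l) ⟨
  ℚ.toℚᵘ (ℤ⇒ℚ k + ℤ⇒ℚ l)                  ∎)
  where open ℚᵘ.≃-Reasoning

ℤ⇒ℚ-homo‿- : ∀ k → ℤ⇒ℚ (ℤ.- k) ≡ - ℤ⇒ℚ k
ℤ⇒ℚ-homo‿- k = ℚ.toℚᵘ-injective (begin
  ℚ.toℚᵘ (ℤ⇒ℚ (ℤ.- k))      ≈⟨ toℚᵘ-ℤ⇒ℚ (ℤ.- k) ⟩
  mkℚᵘ (ℤ.- k) 0            ≈⟨ ℚᵘ.-‿cong (toℚᵘ-ℤ⇒ℚ k) ⟨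
  ℚᵘ.- ℚ.toℚᵘ (ℤ⇒ℚ k)       ≈⟨ ℚ.toℚᵘ-homo‿- (ℤ⇒ℚ k) ⟨
  ℚ.toℚᵘ (- ℤ⇒ℚ k)          ∎)
  where open ℚᵘ.≃-Reasoning

ℤ⇒ℚ-mono-≤ : ∀ {k l} → k ℤ.≤ l → ℤ⇒ℚ k ≤ ℤ⇒ℚ l
ℤ⇒ℚ-mono-≤ {k} {l} k≤l = ℚ.toℚᵘ-cancel-≤
  (ℚᵘ.≤-respˡ-≃ (ℚᵘ.≃-sym (toℚᵘ-ℤ⇒ℚ k)) (ℚᵘ.≤-respʳ-≃ (ℚᵘ.≃-sym (toℚᵘ-ℤ⇒ℚ l))
    (*≤* (ℤ.*-monoʳ-≤-nonNeg 1ℤ k≤l))))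

ℤ⇒ℚ-injective : ∀ {k l} → ℤ⇒ℚ k ≡ ℤ⇒ℚ l → k ≡ l
ℤ⇒ℚ-injective {k} {l} eq with ℚᵘ.≃-trans (ℚᵘ.≃-sym (toℚᵘ-ℤ⇒ℚ k))
  (ℚᵘ.≃-trans (ℚ.toℚᵘ-cong eq) (toℚᵘ-ℤ⇒ℚ l))
... | *≡* k*1≡l*1 = ℤ.*-cancelʳ-≡ k l 1ℤ k*1≡l*1

-- The commutative ring ℝ

Eventually : (ℕ → Set) → Set
Eventually P = ∃[ N ] (∀ n → N ℕ.≤ n → P n)

eventually-map : ∀ {P Q : ℕ → Set} → (∀ n → P n → Q n) → Eventually P → Eventually Q
eventually-map f (N , p) = N , λ n n≥N → f n (p n n≥N)

eventually-zip : ∀ {P Q R : ℕ → Set} → (∀ n → P n → Q n → R n) →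
                 Eventually P → Eventually Q → Eventually R
eventually-zip f (M , p) (N , q) = M ⊔ N , λ n n≥ →
  f n (p n (ℕ.m⊔n≤o⇒m≤o M N n≥)) (q n (ℕ.m⊔n≤o⇒n≤o M N n≥))

eventually⇒∃ : ∀ {P : ℕ → Set} → Eventually P → ∃[ n ] P n
eventually⇒∃ (N , p) = N , p N ℕ.≤-refl

pointwise : ∀ x y → (∀ n → seq x n ≡ seq y n) → x ≈ᵣ y
pointwise x y eq ε ε>0 = 0 , λ n _ →
  subst (λ d → ∣ d ∣ < ε) (trans (sym (ℚ.+-inverseʳ (seq y n))) (cong (_- seq y n) (sym (eq n)))) ε>0

≈ᵣ-refl : ∀ x → x ≈ᵣ x
≈ᵣ-refl x = pointwise x x λ _ → refl

≈ᵣ-sym : ∀ x y → x ≈ᵣ y → y ≈ᵣ x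
≈ᵣ-sym x y x≈y ε ε>0 = eventually-map
  (λ n → subst (_< ε) (trans (sym (ℚ.∣-p∣≡∣p∣ (seq x n - seq y n)))
    (cong ∣_∣ (solve 2 (λ a b → :- (a :- b) := b :- a) refl (seq x n) (seq y n)))))
  (x≈y ε ε>0)

∣p∣+∣q∣<⇒∣p+q∣< : ∀ {p q δ ε} → ∣ p ∣ < δ → ∣ q ∣ < ε → ∣ p + q ∣ < δ + ε
∣p∣+∣q∣<⇒∣p+q∣< {p} {q} p<δ q<ε = ℚ.≤-<-trans (ℚ.∣p+q∣≤∣p∣+∣q∣ p q) (ℚ.+-mono-< p<δ q<ε)

≈ᵣ-trans : ∀ x y z → x ≈ᵣ y → y ≈ᵣ z → x ≈ᵣ z
≈ᵣ-trans x y z x≈y y≈z ε ε>0 with halve ε>0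
... | δ , δ>0 , δ+δ≡ε = eventually-zip
  (λ n p q → subst₂ _<_
    (cong ∣_∣ (solve 3 (λ a b c → (a :- b) :+ (b :- c) := a :- c) refl (seq x n) (seq y n) (seq z n)))
    δ+δ≡ε
    (∣p∣+∣q∣<⇒∣p+q∣< {seq x n - seq y n} {seq y n - seq z n} p q))
  (x≈y δ δ>0) (y≈z δ δ>0)

+ᵣ-cong : ∀ {x y u v} → x ≈ᵣ y → u ≈ᵣ v → x +ᵣ u ≈ᵣ y +ᵣ v
+ᵣ-cong {x} {y} {u} {v} x≈y u≈v ε ε>0 with halve ε>0
... | δ , δ>0 , δ+δ≡ε = eventually-zip
  (λ n p q → subst₂ _<_
    (cong ∣_∣ (solve 4 (λ a b c d → (a :- b) :+ (c :- d) := (a :+ c) :- (b :+ d)) refl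
      (seq x n) (seq y n) (seq u n) (seq v n)))
    δ+δ≡ε
    (∣p∣+∣q∣<⇒∣p+q∣< {seq x n - seq y n} {seq u n - seq v n} p q))
  (x≈y δ δ>0) (u≈v δ δ>0)

-ᵣ-cong : ∀ {x y} → x ≈ᵣ y → -ᵣ x ≈ᵣ -ᵣ y
-ᵣ-cong {x} {y} x≈y ε ε>0 = eventually-map
  (λ n → subst (_< ε) (trans (sym (ℚ.∣-p∣≡∣p∣ (seq x n - seq y n)))
    (cong ∣_∣ (solve 2 (λ a b → :- (a :- b) := :- a :- (:- b)) refl (seq x n) (seq y n)))))
  (x≈y ε ε>0)

bounded : ∀ x → ∃[ B ] (0ℚ < B × Eventually (λ n → ∣ seq x n ∣ < B))
bounded x with cauchy x 1ℚ 0<1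
... | N , close = 1ℚ + ∣ seq x N ∣ , ℚ.+-mono-<-≤ 0<1 (ℚ.0≤∣p∣ (seq x N)) , N , λ n n≥N →
  ℚ.≤-<-trans
    (subst (λ p → ∣ p ∣ ≤ ∣ seq x n - seq x N ∣ + ∣ seq x N ∣)
      (solve 2 (λ a b → (a :- b) :+ b := a) refl (seq x n) (seq x N))
      (ℚ.∣p+q∣≤∣p∣+∣q∣ (seq x n - seq x N) (seq x N)))
    (ℚ.+-monoˡ-< ∣ seq x N ∣ (close n N n≥N ℕ.≤-refl))

∣p*q∣<B*δ : ∀ p q {B δ} → 0ℚ < B → ∣ p ∣ < B → ∣ q ∣ < δ → ∣ p * q ∣ < B * δ
∣p*q∣<B*δ p q {B} {δ} B>0 p<B q<δ = begin-strict
  ∣ p * q ∣      ≡⟨ ℚ.∣p*q∣≡∣p∣*∣q∣ p q ⟩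
  ∣ p ∣ * ∣ q ∣  ≤⟨ ℚ.*-monoʳ-≤-nonNeg ∣ q ∣ {{ℚ.∣-∣-nonNeg q}} (ℚ.<⇒≤ p<B) ⟩
  B * ∣ q ∣      <⟨ ℚ.*-monoʳ-<-pos B {{ℚ.positive B>0}} q<δ ⟩
  B * δ          ∎
  where open ℚ.≤-Reasoning

-- The Cauchy sequence of `z` is eventually below some B in absolute value, so it suffices that `x`
-- and `y` differ by less than ε / B.
*ᵣ-congˡ : ∀ z {x y} → x ≈ᵣ y → z *ᵣ x ≈ᵣ z *ᵣ y
*ᵣ-congˡ z {x} {y} x≈y ε ε>0 =
  let B , B>0 , z<B = bounded z
      δ , δ>0 , Bδ≡ε = divide ε>0 B>0
  in eventually-zip (λ n p q → subst₂ _<_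
    (cong ∣_∣ (solve 3 (λ a b c → a :* (b :- c) := a :* b :- a :* c) refl
      (seq z n) (seq x n) (seq y n)))
    Bδ≡ε (∣p*q∣<B*δ (seq z n) (seq x n - seq y n) B>0 p q))
    z<B (x≈y δ δ>0)

*ᵣ-cong : ∀ {x y u v} → x ≈ᵣ y → u ≈ᵣ v → x *ᵣ u ≈ᵣ y *ᵣ v
*ᵣ-cong {x} {y} {u} {v} x≈y u≈v =
  ≈ᵣ-trans (x *ᵣ u) (x *ᵣ v) (y *ᵣ v) (*ᵣ-congˡ x {u} {v} u≈v)
    (≈ᵣ-trans (x *ᵣ v) (v *ᵣ x) (y *ᵣ v) (swap x v)
      (≈ᵣ-trans (v *ᵣ x) (v *ᵣ y) (y *ᵣ v) (*ᵣ-congˡ v {x} {y} x≈y) (swap v y)))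
  where
  swap : ∀ a b → a *ᵣ b ≈ᵣ b *ᵣ a
  swap a b = pointwise (a *ᵣ b) (b *ᵣ a) λ n → ℚ.*-comm (seq a n) (seq b n)

ℝ-commutativeRing : CommutativeRing 0ℓ 0ℓ
ℝ-commutativeRing = record
  { Carrier = ℝ ; _≈_ = _≈ᵣ_ ; _+_ = _+ᵣ_ ; _*_ = _*ᵣ_ ; -_ = -ᵣ_ ; 0# = 0ᵣ ; 1# = 1ᵣ
  ; isCommutativeRing = record
    { isRing = record
      { +-isAbelianGroup = record
        { isGroup = record
          { isMonoid = record
            { isSemigroup = record
              { isMagma = record
                { isEquivalence = record
                  { refl = λ {x} → ≈ᵣ-refl x
                  ; sym = λ {x} {y} → ≈ᵣ-sym x y
                  ; trans = λ {x} {y} {z} → ≈ᵣ-trans x y z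
                  }
                ; ∙-cong = λ {x} {y} {u} {v} → +ᵣ-cong {x} {y} {u} {v}
                }
              ; assoc = λ x y z → pointwise (x +ᵣ y +ᵣ z) (x +ᵣ (y +ᵣ z)) λ n →
                  ℚ.+-assoc (seq x n) (seq y n) (seq z n)
              }
            ; identity = (λ x → pointwise (0ᵣ +ᵣ x) x λ n → ℚ.+-identityˡ (seq x n))
                       , (λ x → pointwise (x +ᵣ 0ᵣ) x λ n → ℚ.+-identityʳ (seq x n))
            }
          ; inverse = (λ x → pointwise (-ᵣ x +ᵣ x) 0ᵣ λ n → ℚ.+-inverseˡ (seq x n))
                    , (λ x → pointwise (x +ᵣ -ᵣ x) 0ᵣ λ n → ℚ.+-inverseʳ (seq x n))
          ; ⁻¹-cong = λ {x} {y} → -ᵣ-cong {x} {y}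
          }
        ; comm = λ x y → pointwise (x +ᵣ y) (y +ᵣ x) λ n → ℚ.+-comm (seq x n) (seq y n)
        }
      ; *-cong = λ {x} {y} {u} {v} → *ᵣ-cong {x} {y} {u} {v}
      ; *-assoc = λ x y z → pointwise (x *ᵣ y *ᵣ z) (x *ᵣ (y *ᵣ z)) λ n →
          ℚ.*-assoc (seq x n) (seq y n) (seq z n)
      ; *-identity = (λ x → pointwise (1ᵣ *ᵣ x) x λ n → ℚ.*-identityˡ (seq x n))
                   , (λ x → pointwise (x *ᵣ 1ᵣ) x λ n → ℚ.*-identityʳ (seq x n))
      ; distrib = (λ x y z → pointwise (x *ᵣ (y +ᵣ z)) (x *ᵣ y +ᵣ x *ᵣ z) λ n →
                     ℚ.*-distribˡ-+ (seq x n) (seq y n) (seq z n))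
                , (λ x y z → pointwise ((y +ᵣ z) *ᵣ x) (y *ᵣ x +ᵣ z *ᵣ x) λ n →
                     ℚ.*-distribʳ-+ (seq x n) (seq y n) (seq z n))
      }
    ; *-comm = λ x y → pointwise (x *ᵣ y) (y *ᵣ x) λ n → ℚ.*-comm (seq x n) (seq y n)
    }
  }

-- The order on ℝ

-- One rational margin must serve all late indices; positivity of the individual terms would not
-- exclude the limit 0. Strict order is positivity of a difference, so comparisons reduce to closure
-- properties of `Pos`.
Pos : ℝ → Set
Pos x = ∃[ ε ] (0ℚ < ε × Eventually (λ n → ε < seq x n))

<ᵣ⇒Pos : ∀ x y → x <ᵣ y → Pos (y -ᵣ x)
<ᵣ⇒Pos x y (ε , ε>0 , ev) = ε , ε>0 , eventually-map
  (λ n h → linear₁ h (solve 3 (λ a b e → b :- (a :+ e) := b :- a :- e) refl (seq x n) (seq y n) ε)) ev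

Pos⇒<ᵣ : ∀ x y → Pos (y -ᵣ x) → x <ᵣ y
Pos⇒<ᵣ x y (ε , ε>0 , ev) = ε , ε>0 , eventually-map
  (λ n h → linear₁ h (solve 3 (λ a b e → b :- a :- e := b :- (a :+ e)) refl (seq x n) (seq y n) ε)) ev

Pos-resp-≈ : ∀ x y → x ≈ᵣ y → Pos x → Pos y
Pos-resp-≈ x y x≈y (ε , ε>0 , ev) with halve ε>0
... | δ , δ>0 , refl = δ , δ>0 , eventually-zip
  (λ n h close → linear₂ h (∣p∣<q⇒p<q close)
    (solve 3 (λ a b d → (a :- (d :+ d)) :+ (d :- (a :- b)) := b :- d) refl (seq x n) (seq y n) δ))
  ev (x≈y δ δ>0)

Pos-+ : ∀ x y → Pos x → Pos y → Pos (x +ᵣ y)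
Pos-+ x y (ε , ε>0 , x>ε) (δ , δ>0 , y>δ) =
  ε + δ , ℚ.+-mono-< ε>0 δ>0 , eventually-zip (λ n → ℚ.+-mono-<) x>ε y>δ

Pos-* : ∀ x y → Pos x → Pos y → Pos (x *ᵣ y)
Pos-* x y (ε , ε>0 , x>ε) (δ , δ>0 , y>δ) = ε * δ , 0<p*q ε>0 δ>0 , eventually-zip
  (λ n p q → ℚ.<-trans (ℚ.*-monoʳ-<-pos ε {{ℚ.positive ε>0}} q)
                       (ℚ.*-monoˡ-<-pos (seq y n) {{ℚ.positive (ℚ.<-trans δ>0 q)}} p))
  x>ε y>δ

Pos-ℚ : ∀ {q} → 0ℚ < q → Pos (ℚ⇒ℝ q)
Pos-ℚ q>0 with ℚ.<-dense q>0
... | ε , ε>0 , ε<q = ε , ε>0 , 0 , λ _ _ → ε<q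

Pos-ℚ⁻¹ : ∀ {q} → Pos (ℚ⇒ℝ q) → 0ℚ < q
Pos-ℚ⁻¹ (ε , ε>0 , ev) = ℚ.<-trans ε>0 (proj₂ (eventually⇒∃ ev))

¬Pos0 : ¬ Pos 0ᵣ
¬Pos0 pos = ℚ.<-irrefl refl (Pos-ℚ⁻¹ pos)

-- Differences of digits are rational constants that may vanish, which `Pos-+` cannot absorb.
Pos-+-ℚ : ∀ x {q} → Pos x → 0ℚ ≤ q → Pos (x +ᵣ ℚ⇒ℝ q)
Pos-+-ℚ x {q} (ε , ε>0 , ev) q≥0 = ε , ε>0 , eventually-map
  (λ n ε<x → subst (_< seq x n + q) (ℚ.+-identityʳ ε) (ℚ.+-mono-<-≤ ε<x q≥0)) ev

-- From x y > η and 0 < x < B follows y > η / B, a margin independent of the index.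
Pos-cancelˡ-* : ∀ x y → Pos x → Pos (x *ᵣ y) → Pos y
Pos-cancelˡ-* x y (ε , ε>0 , x>ε) (η , η>0 , xy>η) =
  let B , B>0 , ∣x∣<B = bounded x
      δ , δ>0 , Bδ≡η = divide η>0 B>0
  in δ , δ>0 , eventually-zip
    (λ n p q → large (seq x n) (seq y n) B δ δ>0
      (ℚ.<-trans ε>0 (proj₁ p)) (∣p∣<q⇒p<q (proj₂ p)) (subst (_< seq x n * seq y n) (sym Bδ≡η) q))
    (eventually-zip (λ n → _,_) x>ε ∣x∣<B) xy>η
  where
  large : ∀ a b B δ → 0ℚ < δ → 0ℚ < a → a < B → B * δ < a * b → δ < b
  large a b B δ δ>0 a>0 a<B h = ℚ.*-cancelˡ-<-nonNeg a {{ℚ.nonNegative (ℚ.<⇒≤ a>0)}}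
    (ℚ.<-trans (ℚ.*-monoˡ-<-pos δ {{ℚ.positive δ>0}} a<B) h)

-- Deciding x N > 2δ at an index where the sequence varies by less than δ,
-- with 4δ the margin of x + y, is what makes the disjunction constructive.
Pos-split : ∀ x y → Pos (x +ᵣ y) → Pos x ⊎ Pos y
Pos-split x y (ε , ε>0 , ev) with halve ε>0
... | η , η>0 , refl with halve η>0
... | δ , δ>0 , refl with cauchy x δ δ>0
... | N , close with (δ + δ) ℚ.<? seq x N
... | yes 2δ<x = inj₁ (δ , δ>0 , N , λ n n≥N →
        linear₂ 2δ<x (∣p∣<q⇒-p<q {seq x n - seq x N} (close n N n≥N ℕ.≤-refl))
          (solve 3 (λ d a b → (b :- (d :+ d)) :+ (d :- (:- (a :- b))) := a :- d)
            refl δ (seq x n) (seq x N)))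
... | no 2δ≮x = inj₂ (δ , δ>0 , eventually-zip
        (λ n xn<3δ h → linear₂ h xn<3δ
          (solve 3 (λ d a b → ((a :+ b) :- (d :+ d :+ (d :+ d))) :+ (d :+ d :+ d :- a) := b :- d)
            refl δ (seq x n) (seq y n)))
        (N , λ n n≥N → subst (_< δ + δ + δ)
          (solve 2 (λ a b → b :+ (a :- b) := a) refl (seq x n) (seq x N))
          (ℚ.+-mono-≤-< (ℚ.≮⇒≥ 2δ≮x) (∣p∣<q⇒p<q (close n N n≥N ℕ.≤-refl))))
        ev)

-- The positive number ε is x + (ε - x), so `Pos-split` makes one summand positive, and the first is
-- excluded.
¬Pos⇒eventually< : ∀ x → ¬ Pos x → ∀ ε → 0ℚ < ε → Eventually (λ n → seq x n < ε)
¬Pos⇒eventually< x ¬x>0 ε ε>0 = [ (λ x>0 → contradiction x>0 ¬x>0) , below ]′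
  (Pos-split x (ℚ⇒ℝ ε -ᵣ x) (Pos-resp-≈ (ℚ⇒ℝ ε) (x +ᵣ (ℚ⇒ℝ ε -ᵣ x))
    (pointwise (ℚ⇒ℝ ε) (x +ᵣ (ℚ⇒ℝ ε -ᵣ x)) λ n →
      solve 2 (λ e a → e := a :+ (e :- a)) refl ε (seq x n)) (Pos-ℚ ε>0)))
  where
  below : Pos (ℚ⇒ℝ ε -ᵣ x) → Eventually (λ n → seq x n < ε)
  below (δ , δ>0 , ev) = eventually-map (λ n h → linear₂ h δ>0
    (solve 3 (λ e d a → (e :- a :- d) :+ (d :- con 0ℚ) := e :- a) refl ε δ (seq x n))) ev

¬Pos⇒≈0 : ∀ x → ¬ Pos x → ¬ Pos (-ᵣ x) → x ≈ᵣ 0ᵣ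
¬Pos⇒≈0 x ¬x>0 ¬x<0 ε ε>0 = eventually-zip
  (λ n p q → subst (λ d → ∣ d ∣ < ε) (solve 1 (λ a → a := a :- con 0ℚ) refl (seq x n))
    (p<q×-p<q⇒∣p∣<q p q))
  (¬Pos⇒eventually< x ¬x>0 ε ε>0) (¬Pos⇒eventually< (-ᵣ x) ¬x<0 ε ε>0)

Pos*≈0⇒≈0 : ∀ x y → Pos x → x *ᵣ y ≈ᵣ 0ᵣ → y ≈ᵣ 0ᵣ
Pos*≈0⇒≈0 x y x>0 xy≈0 = ¬Pos⇒≈0 y
  (λ y>0 → ¬Pos0 (Pos-resp-≈ (x *ᵣ y) 0ᵣ xy≈0 (Pos-* x y x>0 y>0)))
  (λ y<0 → ¬Pos0 (Pos-resp-≈ (x *ᵣ -ᵣ y) 0ᵣ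
    (≈ᵣ-trans (x *ᵣ -ᵣ y) (-ᵣ (x *ᵣ y)) 0ᵣ
      (pointwise (x *ᵣ -ᵣ y) (-ᵣ (x *ᵣ y)) λ n →
        solve 2 (λ a b → a :* (:- b) := :- (a :* b)) refl (seq x n) (seq y n))
      (≈ᵣ-trans (-ᵣ (x *ᵣ y)) (-ᵣ 0ᵣ) 0ᵣ (-ᵣ-cong {x *ᵣ y} {0ᵣ} xy≈0)
        (pointwise (-ᵣ 0ᵣ) 0ᵣ λ _ → refl)))
    (Pos-* x (-ᵣ y) x>0 y<0)))

-- Which factor vanishes cannot be decided constructively, hence the form of a contradiction. If x
-- were positive or negative, y could be isolated and would vanish; so x is neither, which already
-- makes it 0.
ℝ-noZeroDivisors : ∀ x y → x *ᵣ y ≈ᵣ 0ᵣ → ¬ x ≈ᵣ 0ᵣ → ¬ y ≈ᵣ 0ᵣ → ⊥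
ℝ-noZeroDivisors x y xy≈0 x≉0 y≉0 = x≉0 (¬Pos⇒≈0 x
  (λ x>0 → y≉0 (Pos*≈0⇒≈0 x y x>0 xy≈0))
  (λ x<0 → y≉0 (Pos*≈0⇒≈0 (-ᵣ x) y x<0
    (≈ᵣ-trans (-ᵣ x *ᵣ y) (-ᵣ (x *ᵣ y)) 0ᵣ
      (pointwise (-ᵣ x *ᵣ y) (-ᵣ (x *ᵣ y)) λ n →
        solve 2 (λ a b → (:- a) :* b := :- (a :* b)) refl (seq x n) (seq y n))
      (≈ᵣ-trans (-ᵣ (x *ᵣ y)) (-ᵣ 0ᵣ) 0ᵣ (-ᵣ-cong {x *ᵣ y} {0ᵣ} xy≈0)
        (pointwise (-ᵣ 0ᵣ) 0ᵣ λ _ → refl))))))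

-- Polynomials over ℚ

coeff-+ₚ : ∀ p q i → coeff (p +ₚ q) i ≡ coeff p i + coeff q i
coeff-+ₚ []      q       i       = sym (ℚ.+-identityˡ (coeff q i))
coeff-+ₚ (a ∷ p) []      i       = sym (ℚ.+-identityʳ (coeff (a ∷ p) i))
coeff-+ₚ (a ∷ p) (b ∷ q) zero    = refl
coeff-+ₚ (a ∷ p) (b ∷ q) (suc i) = coeff-+ₚ p q i

coeff-scale : ∀ a p i → coeff (map (a *_) p) i ≡ a * coeff p i
coeff-scale a []      i       = sym (ℚ.*-zeroʳ a)
coeff-scale a (b ∷ p) zero    = refl
coeff-scale a (b ∷ p) (suc i) = coeff-scale a p i

coeff-beyond-length : ∀ p i → length p ℕ.≤ i → coeff p i ≡ 0ℚ
coeff-beyond-length []      i       _         = refl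
coeff-beyond-length (a ∷ p) (suc i) (s≤s p≤i) = coeff-beyond-length p i p≤i

+ₚ-cong : ∀ {p p′ q q′} → p ≈ₚ p′ → q ≈ₚ q′ → p +ₚ q ≈ₚ p′ +ₚ q′
+ₚ-cong {p} {p′} {q} {q′} p≈p′ q≈q′ i =
  trans (coeff-+ₚ p q i) (trans (cong₂ _+_ (p≈p′ i) (q≈q′ i)) (sym (coeff-+ₚ p′ q′ i)))

*ₚ-zeroˡ : ∀ {p} q → p ≈ₚ [] → p *ₚ q ≈ₚ []
*ₚ-zeroˡ {[]}    q p≈0 i = refl
*ₚ-zeroˡ {a ∷ p} q p≈0 i = begin
  coeff (map (a *_) q +ₚ (0ℚ ∷ p *ₚ q)) i             ≡⟨ coeff-+ₚ (map (a *_) q) _ i ⟩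
  coeff (map (a *_) q) i + coeff (0ℚ ∷ p *ₚ q) i      ≡⟨ cong₂ _+_ (coeff-scale a q i) (tail≈0 i) ⟩
  a * coeff q i + 0ℚ                                  ≡⟨ cong (λ a → a * coeff q i + 0ℚ) (p≈0 0) ⟩
  0ℚ * coeff q i + 0ℚ                                 ≡⟨ cong (_+ 0ℚ) (ℚ.*-zeroˡ (coeff q i)) ⟩
  0ℚ                                                  ∎
  where
  open ≡-Reasoning
  tail≈0 : 0ℚ ∷ p *ₚ q ≈ₚ []
  tail≈0 zero    = refl
  tail≈0 (suc i) = *ₚ-zeroˡ {p} q (p≈0 ∘ suc) i

*ₚ-congʳ : ∀ {p p′} q → p ≈ₚ p′ → p *ₚ q ≈ₚ p′ *ₚ q
*ₚ-congʳ {[]}    {p′}     q p≈p′ i = sym (*ₚ-zeroˡ {p′} q (λ j → sym (p≈p′ j)) i)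
*ₚ-congʳ {a ∷ p} {[]}     q p≈p′ i = *ₚ-zeroˡ {a ∷ p} q p≈p′ i
*ₚ-congʳ {a ∷ p} {b ∷ p′} q p≈p′ rewrite p≈p′ 0 =
  +ₚ-cong {map (b *_) q} {map (b *_) q} (λ _ → refl) tails
  where
  tails : 0ℚ ∷ p *ₚ q ≈ₚ 0ℚ ∷ p′ *ₚ q
  tails zero    = refl
  tails (suc i) = *ₚ-congʳ {p} {p′} q (p≈p′ ∘ suc) i

-- Degrees and division with remainder

VanishesFrom : ℕ → ℚ[x] → Set
VanishesFrom n p = ∀ i → n ℕ.≤ i → coeff p i ≡ 0ℚ

vanishes-below : ∀ n p → VanishesFrom (suc n) p → coeff p n ≡ 0ℚ → VanishesFrom n p
vanishes-below n p v pₙ≡0 i n≤i with ℕ.m≤n⇒m<n∨m≡n n≤i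
... | inj₁ n<i  = v i n<i
... | inj₂ refl = pₙ≡0

-- The search runs downward from the bound and uses that equality in ℚ is decidable.
zero-or-degree : ∀ n p → VanishesFrom n p → p ≈ₚ [] ⊎ ∃[ d ] (d ℕ.< n × HasDegree p d)
zero-or-degree zero    p v = inj₁ λ i → v i z≤n
zero-or-degree (suc n) p v with coeff p n ℚ.≟ 0ℚ
... | no  pₙ≢0 = inj₂ (n , ℕ.≤-refl , pₙ≢0 , v)
... | yes pₙ≡0 with zero-or-degree n p (vanishes-below n p v pₙ≡0)
...   | inj₁ p≈0             = inj₁ p≈0
...   | inj₂ (d , d<n , deg) = inj₂ (d , ℕ.m<n⇒m<1+n d<n , deg)

degree-unique : ∀ {p d e} → HasDegree p d → HasDegree p e → d ≡ e
degree-unique {p} {d} {e} (pd≢0 , >d) (pe≢0 , >e) =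
  ℕ.≤-antisym (ℕ.≮⇒≥ λ e<d → pd≢0 (>e d e<d)) (ℕ.≮⇒≥ λ d<e → pe≢0 (>d e d<e))

-- The length of the quotient is recorded because it bounds its degree: if `G` lists n + 1
-- coefficients, the quotient has degree below n, which puts it within reach of minimality.
record Division (G F : ℚ[x]) (d : ℕ) : Set where
  field
    quotient remainder : ℚ[x]
    quotient-length    : length quotient ≡ length G ℕ.∸ 1
    remainder-small    : VanishesFrom d remainder
    decomposition      : G ≈ₚ quotient *ₚ F +ₚ remainder

-- If G = q F + r, then a + x G = x q F + (a + x r). The shift moves the coefficient t of r from
-- place d to place d + 1, where subtracting s F with s = t / lead cancels it.
divide-step : ∀ a {b G} F d → HasDegree F (suc d) → Division (b ∷ G) F (suc d) →
              Division (a ∷ b ∷ G) F (suc d)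
divide-step a {b} {G′} F d (lead≢0 , F-small) D = record
  { quotient = s ∷ quotient
  ; remainder = R
  ; quotient-length = cong suc quotient-length
  ; remainder-small = R-small
  ; decomposition = decomposition′
  }
  where
  open Division D
  G = b ∷ G′
  instance
    lead≠0 = ℚ.≢-nonZero lead≢0
  lead = coeff F (suc d)
  t = coeff remainder d
  s = t * ℚ.1/ lead
  R = (a ∷ remainder) +ₚ map (- s *_) F

  coeff-R : ∀ i → coeff R i ≡ coeff (a ∷ remainder) i + - s * coeff F i
  coeff-R i = trans (coeff-+ₚ (a ∷ remainder) (map (- s *_) F) i)
    (cong (coeff (a ∷ remainder) i +_) (coeff-scale (- s) F i))

  R-small : VanishesFrom (suc d) R
  R-small (suc i) (s≤s d≤i) with ℕ.m≤n⇒m<n∨m≡n d≤i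
  ... | inj₁ d<i  = trans (coeff-R (suc i))
    (trans (cong₂ (λ x y → x + - s * y) (remainder-small i d<i) (F-small (suc i) (s≤s d<i)))
      (solve 1 (λ s → con 0ℚ :+ :- s :* con 0ℚ := con 0ℚ) refl s))
  ... | inj₂ refl = trans (coeff-R (suc i))
    (trans (solve 3 (λ t l l⁻¹ → t :+ :- (t :* l⁻¹) :* l := t :- t :* (l⁻¹ :* l)) refl
             t lead (ℚ.1/ lead))
      (trans (cong (λ u → t - t * u) (ℚ.*-inverseˡ lead))
        (solve 1 (λ t → t :- t :* con 1ℚ := con 0ℚ) refl t)))

  decomposition′ : a ∷ G ≈ₚ (s ∷ quotient) *ₚ F +ₚ R
  decomposition′ i = sym (trans (coeff-+ₚ ((s ∷ quotient) *ₚ F) R i)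
    (trans (cong₂ _+_ (trans (coeff-+ₚ (map (s *_) F) (0ℚ ∷ quotient *ₚ F) i)
                       (cong (_+ coeff (0ℚ ∷ quotient *ₚ F) i) (coeff-scale s F i)))
                      (coeff-R i))
      (trans (solve 4 (λ s f q r → s :* f :+ q :+ (r :+ :- s :* f) := q :+ r) refl
               s (coeff F i) (coeff (0ℚ ∷ quotient *ₚ F) i) (coeff (a ∷ remainder) i))
        (shifted i))))
    where
    shifted : ∀ i → coeff (0ℚ ∷ quotient *ₚ F) i + coeff (a ∷ remainder) i ≡ coeff (a ∷ G) i
    shifted zero    = ℚ.+-identityˡ a
    shifted (suc i) = sym (trans (decomposition i) (coeff-+ₚ (quotient *ₚ F) remainder i))

divideₚ : ∀ G F d → HasDegree F (suc d) → Division G F (suc d)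
divideₚ []      F d deg = record
  { quotient = [] ; remainder = [] ; quotient-length = refl
  ; remainder-small = λ _ _ → refl ; decomposition = λ _ → refl }
-- A constant is its own remainder. Passing it through `divide-step` would give the quotient one
-- coefficient too many.
divideₚ (a ∷ []) F d deg = record
  { quotient = [] ; remainder = a ∷ [] ; quotient-length = refl
  ; remainder-small = λ { (suc i) _ → refl } ; decomposition = λ _ → refl }
divideₚ (a ∷ G@(_ ∷ _)) F d deg = divide-step a F d deg (divideₚ G F d deg)

-- Evaluation of rational polynomials in a commutative ring

-- β is evaluated in ℝ and its conjugate in ℂ; the same algebra of evaluation serves both.
record RationalAlgebra : Set₁ where
  field
    commutativeRing : CommutativeRing 0ℓ 0ℓ
  open CommutativeRing commutativeRing public renaming
    (_+_ to _+ˢ_; _*_ to _*ˢ_; -_ to -ˢ_; refl to ≈-refl; sym to ≈-sym; trans to ≈-trans)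
  field
    ι   : ℚ → Carrier
    ι-0 : ι 0ℚ ≈ 0#
    ι-+ : ∀ p q → ι (p + q) ≈ ι p +ˢ ι q
    ι-* : ∀ p q → ι (p * q) ≈ ι p *ˢ ι q

module Evaluation (S : RationalAlgebra) where
  open RationalAlgebra S
  open Exp semiring using (_^_)
  open SemiringSolver commutativeSemiring using () renaming
    (solve to solveˢ; con to conˢ; _:+_ to _:+ˢ_; _:*_ to _:*ˢ_; _:=_ to _:=ˢ_)
  open import Relation.Binary.Reasoning.Setoid setoid

  eval : ℚ[x] → Carrier → Carrier
  eval = evalIn rawRing ι

  eval-≈0 : ∀ p x → p ≈ₚ [] → eval p x ≈ 0#
  eval-≈0 []      x _   = ≈-refl
  eval-≈0 (a ∷ p) x p≈0 = begin
    ι a +ˢ x *ˢ eval p x  ≈⟨ +-cong (reflexive (cong ι (p≈0 0))) (*-congˡ (eval-≈0 p x (p≈0 ∘ suc))) ⟩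
    ι 0ℚ +ˢ x *ˢ 0#       ≈⟨ +-cong ι-0 (zeroʳ x) ⟩
    0# +ˢ 0#              ≈⟨ +-identityˡ 0# ⟩
    0#                    ∎

  eval-cong : ∀ p q x → p ≈ₚ q → eval p x ≈ eval q x
  eval-cong []      q       x p≈q = ≈-sym (eval-≈0 q x (λ i → sym (p≈q i)))
  eval-cong (a ∷ p) []      x p≈q = eval-≈0 (a ∷ p) x p≈q
  eval-cong (a ∷ p) (b ∷ q) x p≈q =
    +-cong (reflexive (cong ι (p≈q 0))) (*-congˡ (eval-cong p q x (p≈q ∘ suc)))

  eval-+ : ∀ p q x → eval (p +ₚ q) x ≈ eval p x +ˢ eval q x
  eval-+ []      q       x = ≈-sym (+-identityˡ (eval q x))
  eval-+ (a ∷ p) []      x = ≈-sym (+-identityʳ (eval (a ∷ p) x))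
  eval-+ (a ∷ p) (b ∷ q) x = ≈-trans (+-cong (ι-+ a b) (*-congˡ (eval-+ p q x)))
    (solveˢ 5 (λ a b x p q → (a :+ˢ b) :+ˢ x :*ˢ (p :+ˢ q) :=ˢ (a :+ˢ x :*ˢ p) :+ˢ (b :+ˢ x :*ˢ q)) ≈-refl
      (ι a) (ι b) x (eval p x) (eval q x))

  eval-scale : ∀ a p x → eval (map (a *_) p) x ≈ ι a *ˢ eval p x
  eval-scale a []      x = ≈-sym (zeroʳ (ι a))
  eval-scale a (b ∷ p) x = ≈-trans (+-cong (ι-* a b) (*-congˡ (eval-scale a p x)))
    (solveˢ 4 (λ a b x p → a :*ˢ b :+ˢ x :*ˢ (a :*ˢ p) :=ˢ a :*ˢ (b :+ˢ x :*ˢ p)) ≈-refl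
      (ι a) (ι b) x (eval p x))

  eval-* : ∀ p q x → eval (p *ₚ q) x ≈ eval p x *ˢ eval q x
  eval-* []      q x = ≈-sym (zeroˡ (eval q x))
  eval-* (a ∷ p) q x = begin
    eval (map (a *_) q +ₚ (0ℚ ∷ p *ₚ q)) x
      ≈⟨ eval-+ (map (a *_) q) (0ℚ ∷ p *ₚ q) x ⟩
    eval (map (a *_) q) x +ˢ (ι 0ℚ +ˢ x *ˢ eval (p *ₚ q) x)
      ≈⟨ +-cong (eval-scale a q x) (+-cong ι-0 (*-congˡ (eval-* p q x))) ⟩
    ι a *ˢ eval q x +ˢ (0# +ˢ x *ˢ (eval p x *ˢ eval q x))
      ≈⟨ solveˢ 4 (λ a q x p → a :*ˢ q :+ˢ (conˢ 0 :+ˢ x :*ˢ (p :*ˢ q)) :=ˢ (a :+ˢ x :*ˢ p) :*ˢ q) ≈-refl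
           (ι a) (eval q x) x (eval p x) ⟩
    (ι a +ˢ x *ˢ eval p x) *ˢ eval q x ∎

  eval-∷ʳ : ∀ p a x → eval (p ++ a ∷ []) x ≈ eval p x +ˢ x ^ length p *ˢ ι a
  eval-∷ʳ []      a x = solveˢ 2 (λ a x → a :+ˢ x :*ˢ conˢ 0 :=ˢ conˢ 0 :+ˢ conˢ 1 :*ˢ a) ≈-refl (ι a) x
  eval-∷ʳ (b ∷ p) a x = ≈-trans (+-congˡ (*-congˡ (eval-∷ʳ p a x)))
    (solveˢ 5 (λ b x p n a → b :+ˢ x :*ˢ (p :+ˢ n :*ˢ a) :=ˢ (b :+ˢ x :*ˢ p) :+ˢ (x :*ˢ n) :*ˢ a) ≈-refl
      (ι b) x (eval p x) (x ^ length p) (ι a))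

  -- With y = 1/x, reversing a list of length n gives xⁿ⁻¹ p(1/x). The additional factor x on both
  -- sides keeps the exponent equal to the length, also for the empty list.
  eval-reverse : ∀ p x y → x *ˢ y ≈ 1# → x ^ length p *ˢ eval p y ≈ x *ˢ eval (reverse p) x
  eval-reverse []      x y xy≈1 = solveˢ 1 (λ x → conˢ 1 :*ˢ conˢ 0 :=ˢ x :*ˢ conˢ 0) ≈-refl x
  eval-reverse (a ∷ p) x y xy≈1 = begin
    (x *ˢ xⁿ) *ˢ (ι a +ˢ y *ˢ eval p y)
      ≈⟨ solveˢ 5 (λ x n a y p → (x :*ˢ n) :*ˢ (a :+ˢ y :*ˢ p) :=ˢ x :*ˢ (n :*ˢ a) :+ˢ (x :*ˢ y) :*ˢ (n :*ˢ p))
           ≈-refl x xⁿ (ι a) y (eval p y) ⟩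
    x *ˢ (xⁿ *ˢ ι a) +ˢ (x *ˢ y) *ˢ (xⁿ *ˢ eval p y)
      ≈⟨ +-congˡ (*-cong xy≈1 (eval-reverse p x y xy≈1)) ⟩
    x *ˢ (xⁿ *ˢ ι a) +ˢ 1# *ˢ (x *ˢ eval (reverse p) x)
      ≈⟨ solveˢ 3 (λ x u v → x :*ˢ u :+ˢ conˢ 1 :*ˢ (x :*ˢ v) :=ˢ x :*ˢ (v :+ˢ u)) ≈-refl
           x (xⁿ *ˢ ι a) (eval (reverse p) x) ⟩
    x *ˢ (eval (reverse p) x +ˢ xⁿ *ˢ ι a)
      ≈⟨ *-congˡ (+-congˡ (*-congʳ (reflexive (cong (x ^_) (sym (length-reverse p)))))) ⟩
    x *ˢ (eval (reverse p) x +ˢ x ^ length (reverse p) *ˢ ι a)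
      ≈⟨ *-congˡ (eval-∷ʳ (reverse p) a x) ⟨
    x *ˢ eval (reverse p ++ a ∷ []) x
      ≡⟨ cong (λ q → x *ˢ eval q x) (unfold-reverse a p) ⟨
    x *ˢ eval (reverse (a ∷ p)) x ∎
    where xⁿ = x ^ length p

  reverse-root : ∀ p x y → x *ˢ y ≈ 1# → eval p y ≈ 0# → eval (reverse p) x ≈ 0#
  reverse-root p x y xy≈1 p[y]≈0 = begin
    eval (reverse p) x               ≈⟨ *-identityˡ _ ⟨
    1# *ˢ eval (reverse p) x         ≈⟨ *-congʳ xy≈1 ⟨
    (x *ˢ y) *ˢ eval (reverse p) x   ≈⟨ solveˢ 3 (λ x y r → (x :*ˢ y) :*ˢ r :=ˢ y :*ˢ (x :*ˢ r)) ≈-refl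
                                          x y (eval (reverse p) x) ⟩
    y *ˢ (x *ˢ eval (reverse p) x)   ≈⟨ *-congˡ (eval-reverse p x y xy≈1) ⟨
    y *ˢ (x ^ length p *ˢ eval p y)  ≈⟨ *-congˡ (*-congˡ p[y]≈0) ⟩
    y *ˢ (x ^ length p *ˢ 0#)        ≈⟨ *-congˡ (zeroʳ _) ⟩
    y *ˢ 0#                          ≈⟨ zeroʳ y ⟩
    0#                               ∎

  remainder-root : ∀ {G F d} (D : Division G F d) x → eval G x ≈ 0# → eval F x ≈ 0# →
                   eval (Division.remainder D) x ≈ 0#
  remainder-root {G} {F} D x G≈0 F≈0 = begin
    eval remainder x                                ≈⟨ +-identityˡ _ ⟨
    0# +ˢ eval remainder x                          ≈⟨ +-congʳ (zeroʳ _) ⟨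
    eval quotient x *ˢ 0# +ˢ eval remainder x        ≈⟨ +-congʳ (*-congˡ F≈0) ⟨
    eval quotient x *ˢ eval F x +ˢ eval remainder x  ≈⟨ +-congʳ (eval-* quotient F x) ⟨
    eval (quotient *ₚ F) x +ˢ eval remainder x       ≈⟨ eval-+ (quotient *ₚ F) remainder x ⟨
    eval (quotient *ₚ F +ₚ remainder) x             ≈⟨ eval-cong G (quotient *ₚ F +ₚ remainder) x decomposition ⟨
    eval G x                                        ≈⟨ G≈0 ⟩
    0#                                              ∎
    where open Division D

-- The commutative ring ℂ

pointwiseᶜ : ∀ z w → (∀ n → seq (re z) n ≡ seq (re w) n) →
             (∀ n → seq (im z) n ≡ seq (im w) n) → z ≈ᶜ w
pointwiseᶜ z w re-eq im-eq = pointwise (re z) (re w) re-eq , pointwise (im z) (im w) im-eq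

ℂ-commutativeRing : CommutativeRing 0ℓ 0ℓ
ℂ-commutativeRing = record
  { Carrier = ℂ ; _≈_ = _≈ᶜ_ ; _+_ = _+ᶜ_ ; _*_ = _*ᶜ_ ; -_ = -ᶜ_ ; 0# = 0ᶜ ; 1# = 1ᶜ
  ; isCommutativeRing = record
    { isRing = record
      { +-isAbelianGroup = record
        { isGroup = record
          { isMonoid = record
            { isSemigroup = record
              { isMagma = record
                { isEquivalence = record
                  { refl = λ {x} → ≈ᵣ-refl (re x) , ≈ᵣ-refl (im x)
                  ; sym = λ {x} {y} (p , q) → ≈ᵣ-sym (re x) (re y) p , ≈ᵣ-sym (im x) (im y) q
                  ; trans = λ {x} {y} {z} (p , q) (p′ , q′) →
                      ≈ᵣ-trans (re x) (re y) (re z) p p′ , ≈ᵣ-trans (im x) (im y) (im z) q q′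
                  }
                ; ∙-cong = λ {x} {y} {u} {v} (p , q) (p′ , q′) →
                    +ᵣ-cong {re x} {re y} {re u} {re v} p p′ ,
                    +ᵣ-cong {im x} {im y} {im u} {im v} q q′
                }
              ; assoc = λ x y z → pointwiseᶜ ((x +ᶜ y) +ᶜ z) (x +ᶜ (y +ᶜ z))
                  (λ n → ℚ.+-assoc (Re x n) (Re y n) (Re z n))
                  (λ n → ℚ.+-assoc (Im x n) (Im y n) (Im z n))
              }
            ; identity = (λ x → pointwiseᶜ (0ᶜ +ᶜ x) x
                            (λ n → ℚ.+-identityˡ (Re x n)) (λ n → ℚ.+-identityˡ (Im x n)))
                       , (λ x → pointwiseᶜ (x +ᶜ 0ᶜ) x
                            (λ n → ℚ.+-identityʳ (Re x n)) (λ n → ℚ.+-identityʳ (Im x n)))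
            }
          ; inverse = (λ x → pointwiseᶜ ((-ᶜ x) +ᶜ x) 0ᶜ
                         (λ n → ℚ.+-inverseˡ (Re x n)) (λ n → ℚ.+-inverseˡ (Im x n)))
                    , (λ x → pointwiseᶜ (x +ᶜ (-ᶜ x)) 0ᶜ
                         (λ n → ℚ.+-inverseʳ (Re x n)) (λ n → ℚ.+-inverseʳ (Im x n)))
          ; ⁻¹-cong = λ {x} {y} (p , q) → -ᵣ-cong {re x} {re y} p , -ᵣ-cong {im x} {im y} q
          }
        ; comm = λ x y → pointwiseᶜ (x +ᶜ y) (y +ᶜ x)
            (λ n → ℚ.+-comm (Re x n) (Re y n)) (λ n → ℚ.+-comm (Im x n) (Im y n))
        }
      ; *-cong = λ {x} {y} {u} {v} → *ᶜ-cong x y u v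
      ; *-assoc = λ x y z → pointwiseᶜ ((x *ᶜ y) *ᶜ z) (x *ᶜ (y *ᶜ z))
          (λ n → solve 6 (λ a b c d e f →
              (a :* c :+ :- (b :* d)) :* e :+ :- ((a :* d :+ b :* c) :* f)
           := a :* (c :* e :+ :- (d :* f)) :+ :- (b :* (c :* f :+ d :* e))) refl
             (Re x n) (Im x n) (Re y n) (Im y n) (Re z n) (Im z n))
          (λ n → solve 6 (λ a b c d e f →
              (a :* c :+ :- (b :* d)) :* f :+ (a :* d :+ b :* c) :* e
           := a :* (c :* f :+ d :* e) :+ b :* (c :* e :+ :- (d :* f))) refl
             (Re x n) (Im x n) (Re y n) (Im y n) (Re z n) (Im z n))
      ; *-identity = (λ x → *ᶜ-identityˡ x) , (λ x → pointwiseᶜ (x *ᶜ 1ᶜ) x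
          (λ n → solve 2 (λ a b → a :* con 1ℚ :+ :- (b :* con 0ℚ) := a) refl (Re x n) (Im x n))
          (λ n → solve 2 (λ a b → a :* con 0ℚ :+ b :* con 1ℚ := b) refl (Re x n) (Im x n)))
      ; distrib = (λ x y z → pointwiseᶜ (x *ᶜ (y +ᶜ z)) ((x *ᶜ y) +ᶜ (x *ᶜ z))
          (λ n → solve 6 (λ a b c d e f →
              a :* (c :+ e) :+ :- (b :* (d :+ f))
           := (a :* c :+ :- (b :* d)) :+ (a :* e :+ :- (b :* f))) refl
             (Re x n) (Im x n) (Re y n) (Im y n) (Re z n) (Im z n))
          (λ n → solve 6 (λ a b c d e f →
              a :* (d :+ f) :+ b :* (c :+ e)
           := (a :* d :+ b :* c) :+ (a :* f :+ b :* e)) refl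
             (Re x n) (Im x n) (Re y n) (Im y n) (Re z n) (Im z n)))
        , (λ x y z → pointwiseᶜ ((y +ᶜ z) *ᶜ x) ((y *ᶜ x) +ᶜ (z *ᶜ x))
          (λ n → solve 6 (λ a b c d e f →
              (c :+ e) :* a :+ :- ((d :+ f) :* b)
           := (c :* a :+ :- (d :* b)) :+ (e :* a :+ :- (f :* b))) refl
             (Re x n) (Im x n) (Re y n) (Im y n) (Re z n) (Im z n))
          (λ n → solve 6 (λ a b c d e f →
              (c :+ e) :* b :+ (d :+ f) :* a
           := (c :* b :+ d :* a) :+ (e :* b :+ f :* a)) refl
             (Re x n) (Im x n) (Re y n) (Im y n) (Re z n) (Im z n)))
      }
    ; *-comm = λ x y → pointwiseᶜ (x *ᶜ y) (y *ᶜ x)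
        (λ n → solve 4 (λ a b c d → a :* c :+ :- (b :* d) := c :* a :+ :- (d :* b)) refl
           (Re x n) (Im x n) (Re y n) (Im y n))
        (λ n → solve 4 (λ a b c d → a :* d :+ b :* c := c :* b :+ d :* a) refl
           (Re x n) (Im x n) (Re y n) (Im y n))
    }
  }
  where
  open RawRing ℂ-rawRing
    renaming (_+_ to _+ᶜ_; _*_ to _*ᶜ_; -_ to -ᶜ_; 0# to 0ᶜ; 1# to 1ᶜ) using ()
  Re Im : ℂ → ℕ → ℚ
  Re z = seq (re z)
  Im z = seq (im z)

  *ᶜ-identityˡ : ∀ x → 1ᶜ *ᶜ x ≈ᶜ x
  *ᶜ-identityˡ x = pointwiseᶜ (1ᶜ *ᶜ x) x
    (λ n → solve 2 (λ a b → con 1ℚ :* a :+ :- (con 0ℚ :* b) := a) refl (Re x n) (Im x n))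
    (λ n → solve 2 (λ a b → con 1ℚ :* b :+ con 0ℚ :* a := b) refl (Re x n) (Im x n))

  *ᶜ-cong : ∀ x y u v → x ≈ᶜ y → u ≈ᶜ v → x *ᶜ u ≈ᶜ y *ᶜ v
  *ᶜ-cong x y u v (p , q) (p′ , q′) =
    +ᵣ-cong {re x *ᵣ re u} {re y *ᵣ re v} { -ᵣ (im x *ᵣ im u)} { -ᵣ (im y *ᵣ im v)}
      (*ᵣ-cong {re x} {re y} {re u} {re v} p p′)
      (-ᵣ-cong {im x *ᵣ im u} {im y *ᵣ im v} (*ᵣ-cong {im x} {im y} {im u} {im v} q q′)) ,
    +ᵣ-cong {re x *ᵣ im u} {re y *ᵣ im v} {im x *ᵣ re u} {im y *ᵣ re v}
      (*ᵣ-cong {re x} {re y} {im u} {im v} p q′)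
      (*ᵣ-cong {im x} {im y} {re u} {re v} q p′)

ℝ-rationalAlgebra : RationalAlgebra
ℝ-rationalAlgebra = record
  { commutativeRing = ℝ-commutativeRing
  ; ι   = ℚ⇒ℝ
  ; ι-0 = ≈ᵣ-refl 0ᵣ
  ; ι-+ = λ p q → ≈ᵣ-refl (ℚ⇒ℝ (p + q))
  ; ι-* = λ p q → ≈ᵣ-refl (ℚ⇒ℝ (p * q))
  }

ℂ-rationalAlgebra : RationalAlgebra
ℂ-rationalAlgebra = record
  { commutativeRing = ℂ-commutativeRing
  ; ι   = ℝ⇒ℂ ∘ ℚ⇒ℝ
  ; ι-0 = ≈ᵣ-refl 0ᵣ , ≈ᵣ-refl 0ᵣ
  ; ι-+ = λ p q → ≈ᵣ-refl (ℚ⇒ℝ (p + q)) , ≈ᵣ-refl 0ᵣ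
  ; ι-* = λ p q →
      pointwise (ℚ⇒ℝ (p * q)) (ℚ⇒ℝ p *ᵣ ℚ⇒ℝ q -ᵣ 0ᵣ *ᵣ 0ᵣ)
        (λ _ → solve 2 (λ p q → p :* q := p :* q :+ :- (con 0ℚ :* con 0ℚ)) refl p q) ,
      pointwise 0ᵣ (ℚ⇒ℝ p *ᵣ 0ᵣ +ᵣ 0ᵣ *ᵣ ℚ⇒ℝ q)
        (λ _ → solve 2 (λ p q → con 0ℚ := p :* con 0ℚ :+ con 0ℚ :* q) refl p q)
  }

module Evalᵣ = Evaluation ℝ-rationalAlgebra
module Evalᶜ = Evaluation ℂ-rationalAlgebra

-- Complex conjugation and the unit circle

conj : ℂ → ℂ
conj z = re z +i (-ᵣ im z)

-- The coefficients are real, so conjugation commutes with evaluation exactly at every index, before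
-- any limit is taken.
evalᶜ-conj : ∀ p z n → seq (re (evalᶜ p (conj z))) n ≡ seq (re (evalᶜ p z)) n
                     × seq (im (evalᶜ p (conj z))) n ≡ - seq (im (evalᶜ p z)) n
evalᶜ-conj []      z n = refl , refl
evalᶜ-conj (a ∷ p) z n =
  let re-eq , im-eq = evalᶜ-conj p z n in
  trans (cong₂ (λ u v → a + (seq (re z) n * u - - seq (im z) n * v)) re-eq im-eq)
    (solve 5 (λ a x y u v → a :+ (x :* u :+ :- ((:- y) :* (:- v))) := a :+ (x :* u :+ :- (y :* v)))
      refl a (seq (re z) n) (seq (im z) n) (seq (re (evalᶜ p z)) n) (seq (im (evalᶜ p z)) n)) ,
  trans (cong₂ (λ u v → 0ℚ + (seq (re z) n * v + - seq (im z) n * u)) re-eq im-eq)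
    (solve 4 (λ x y u v → con 0ℚ :+ (x :* (:- v) :+ (:- y) :* u) := :- (con 0ℚ :+ (x :* v :+ y :* u)))
      refl (seq (re z) n) (seq (im z) n) (seq (re (evalᶜ p z)) n) (seq (im (evalᶜ p z)) n))

conj-root : ∀ p z → evalᶜ p z ≈ᶜ ℝ⇒ℂ 0ᵣ → evalᶜ p (conj z) ≈ᶜ ℝ⇒ℂ 0ᵣ
conj-root p z (re≈0 , im≈0) =
  ≈ᵣ-trans (re (evalᶜ p (conj z))) (re (evalᶜ p z)) 0ᵣ
    (pointwise (re (evalᶜ p (conj z))) (re (evalᶜ p z)) (λ n → proj₁ (evalᶜ-conj p z n))) re≈0 ,
  ≈ᵣ-trans (im (evalᶜ p (conj z))) (-ᵣ im (evalᶜ p z)) 0ᵣ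
    (pointwise (im (evalᶜ p (conj z))) (-ᵣ im (evalᶜ p z)) (λ n → proj₂ (evalᶜ-conj p z n)))
    (≈ᵣ-trans (-ᵣ im (evalᶜ p z)) (-ᵣ 0ᵣ) 0ᵣ (-ᵣ-cong {im (evalᶜ p z)} {0ᵣ} im≈0)
      (pointwise (-ᵣ 0ᵣ) 0ᵣ λ _ → refl))

z*conj : ∀ z → ∣ z ∣² ≈ᵣ 1ᵣ → CommutativeRing._*_ ℂ-commutativeRing z (conj z) ≈ᶜ ℝ⇒ℂ 1ᵣ
z*conj z ∣z∣²≈1 =
  ≈ᵣ-trans (re z *ᵣ re z -ᵣ im z *ᵣ -ᵣ im z) ∣ z ∣² 1ᵣ
    (pointwise (re z *ᵣ re z -ᵣ im z *ᵣ -ᵣ im z) ∣ z ∣² λ n →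
      solve 2 (λ a b → a :* a :+ :- (b :* (:- b)) := a :* a :+ b :* b) refl
        (seq (re z) n) (seq (im z) n))
    ∣z∣²≈1 ,
  pointwise (re z *ᵣ -ᵣ im z +ᵣ im z *ᵣ re z) 0ᵣ λ n →
    solve 2 (λ a b → a :* (:- b) :+ b :* a := con 0ℚ) refl (seq (re z) n) (seq (im z) n)

ℚ⇒ℝ≈0⇒≡0 : ∀ q → ℚ⇒ℝ q ≈ᵣ 0ᵣ → q ≡ 0ℚ
ℚ⇒ℝ≈0⇒≡0 q q≈0 with q ℚ.≟ 0ℚ
... | yes q≡0 = q≡0
... | no  q≢0 = contradiction
  (subst (λ p → ∣ p ∣ < ∣ q ∣) (ℚ.+-identityʳ q) (proj₂ (eventually⇒∃ (q≈0 ∣ q ∣ ∣q∣>0))))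
  (ℚ.<-irrefl refl)
  where
  ∣q∣>0 : 0ℚ < ∣ q ∣
  ∣q∣>0 = ℚ.≰⇒> λ ∣q∣≤0 → q≢0 (ℚ.∣p∣≡0⇒p≡0 q (ℚ.≤-antisym ∣q∣≤0 (ℚ.0≤∣p∣ q)))

-- Minimal polynomials

applyUpTo-coeff : ∀ f n i → i ℕ.< n → coeff (applyUpTo f n) i ≡ f i
applyUpTo-coeff f (suc n) zero    _         = refl
applyUpTo-coeff f (suc n) (suc i) (s≤s i<n) = applyUpTo-coeff (f ∘ suc) n i i<n

truncation : ∀ p n → VanishesFrom n p → p ≈ₚ applyUpTo (coeff p) n
truncation p n v i with i ℕ.<? n
... | yes i<n = sym (applyUpTo-coeff (coeff p) n i i<n)
... | no  i≮n = trans (v i (ℕ.≮⇒≥ i≮n)) (sym (coeff-beyond-length (applyUpTo (coeff p) n) i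
  (ℕ.≤-trans (ℕ.≤-reflexive (length-applyUpTo (coeff p) n)) (ℕ.≮⇒≥ i≮n))))

module Minimal {β : ℝ} {P : ℚ[x]} (isMin : IsMinimalPolynomial β P) {n} (degP : HasDegree P n) where
  open IsMinimalPolynomial isMin

  leading : coeff P n ≡ 1ℚ
  leading with d , degP′ , lead ← monic = subst (λ d → coeff P d ≡ 1ℚ) (degree-unique {P} degP′ degP) lead

  small-root⇒zero : ∀ F → VanishesFrom n F → evalᵣ F β ≈ᵣ 0ᵣ → F ≈ₚ []
  small-root⇒zero F v root with zero-or-degree n F v
  ... | inj₁ F≈0             = F≈0
  ... | inj₂ (d , d<n , deg) = contradiction (minimal F n d degP deg root) (ℕ.<⇒≱ d<n)

  private
    -- `P` may carry trailing zeros, which would spoil reversal and the length of quotients; this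
    -- copy has exactly n + 1 entries.
    P̂ = applyUpTo (coeff P) (suc n)

  P≈P̂ : P ≈ₚ P̂
  P≈P̂ = truncation P (suc n) (proj₂ degP)

  P̂-root : evalᵣ P̂ β ≈ᵣ 0ᵣ
  P̂-root = ≈ᵣ-trans (evalᵣ P̂ β) (evalᵣ P β) 0ᵣ
    (≈ᵣ-sym (evalᵣ P β) (evalᵣ P̂ β) (Evalᵣ.eval-cong P P̂ β P≈P̂)) root

  -- If the remainder were zero, `P̂` would be the product of `F` and the quotient, both of degree
  -- below n. By minimality neither factor vanishes at β, but the product does.
  no-proper-divisor : ∀ {F d} (D : Division P̂ F (suc d)) → HasDegree F (suc d) → suc d ℕ.< n →
                      ¬ Division.remainder D ≈ₚ []
  no-proper-divisor {F} {d} D degF d<n R≈0 = ℝ-noZeroDivisors (evalᵣ quotient β) (evalᵣ F β)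
    HF≈0 H≉0 F≉0
    where
    open Division D
    HF≈0 : evalᵣ quotient β *ᵣ evalᵣ F β ≈ᵣ 0ᵣ
    HF≈0 = ≈ᵣ-trans (evalᵣ quotient β *ᵣ evalᵣ F β) (evalᵣ (quotient *ₚ F) β) 0ᵣ
      (≈ᵣ-sym (evalᵣ (quotient *ₚ F) β) (evalᵣ quotient β *ᵣ evalᵣ F β) (Evalᵣ.eval-* quotient F β))
      (≈ᵣ-trans (evalᵣ (quotient *ₚ F) β) (evalᵣ P̂ β) 0ᵣ
        (Evalᵣ.eval-cong (quotient *ₚ F) P̂ β λ i → sym (trans (decomposition i)
          (trans (coeff-+ₚ (quotient *ₚ F) remainder i)
            (trans (cong (coeff (quotient *ₚ F) i +_) (R≈0 i)) (ℚ.+-identityʳ _)))))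
        P̂-root)

    F≉0 : ¬ evalᵣ F β ≈ᵣ 0ᵣ
    F≉0 F≈0 = contradiction (minimal F n (suc d) degP degF F≈0) (ℕ.<⇒≱ d<n)

    H≉0 : ¬ evalᵣ quotient β ≈ᵣ 0ᵣ
    H≉0 H≈0 = proj₁ degP (trans (P≈P̂ n) (trans (decomposition n)
      (trans (coeff-+ₚ (quotient *ₚ F) remainder n)
        (cong₂ _+_ (*ₚ-zeroˡ {quotient} F quotient≈0 n) (R≈0 n)))))
      where
      quotient≈0 : quotient ≈ₚ []
      quotient≈0 = small-root⇒zero quotient
        (λ i n≤i → coeff-beyond-length quotient i (subst (ℕ._≤ i)
          (sym (trans quotient-length (cong (ℕ._∸ 1) (length-applyUpTo (coeff P) (suc n))))) n≤i))
        H≈0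

  module _ {α : ℂ} (P[α]≈0 : evalᶜ P α ≈ᶜ ℝ⇒ℂ 0ᵣ) where
    private
      module ℂᶜ = CommutativeRing ℂ-commutativeRing

    P̂[α]≈0 : evalᶜ P̂ α ≈ᶜ ℝ⇒ℂ 0ᵣ
    P̂[α]≈0 = ℂᶜ.trans {evalᶜ P̂ α} {evalᶜ P α} {ℝ⇒ℂ 0ᵣ}
      (Evalᶜ.eval-cong P̂ P α (λ i → sym (P≈P̂ i))) P[α]≈0

    -- Euclid's algorithm: a nonzero F of least degree vanishing at α divides P.
    no-small-degree : ∀ d F → HasDegree F d → d ℕ.< n → ¬ evalᶜ F α ≈ᶜ ℝ⇒ℂ 0ᵣ
    no-small-degree = <-rec _ descend
      where
      descend : ∀ d → (∀ {e} → e ℕ.< d → ∀ F → HasDegree F e → e ℕ.< n → ¬ evalᶜ F α ≈ᶜ ℝ⇒ℂ 0ᵣ) →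
                ∀ F → HasDegree F d → d ℕ.< n → ¬ evalᶜ F α ≈ᶜ ℝ⇒ℂ 0ᵣ
      descend zero rec F (F₀≢0 , F-const) _ F[α]≈0 = F₀≢0 (ℚ⇒ℝ≈0⇒≡0 F₀
        (≈ᵣ-trans (ℚ⇒ℝ F₀) (re (evalᶜ F α)) 0ᵣ
          (≈ᵣ-trans (ℚ⇒ℝ F₀) (re (evalᶜ (F₀ ∷ []) α)) (re (evalᶜ F α))
            (pointwise (ℚ⇒ℝ F₀) (re (evalᶜ (F₀ ∷ []) α)) λ m →
              solve 3 (λ f x y → f := f :+ (x :* con 0ℚ :+ :- (y :* con 0ℚ))) refl
                F₀ (seq (re α) m) (seq (im α) m))
            (proj₁ (Evalᶜ.eval-cong (F₀ ∷ []) F α λ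
              { zero → refl ; (suc i) → sym (F-const (suc i) (s≤s z≤n)) })))
          (proj₁ F[α]≈0)))
        where F₀ = coeff F 0
      descend (suc d) rec F degF d<n F[α]≈0 with D ← divideₚ P̂ F d degF
        with zero-or-degree (suc d) (Division.remainder D) (Division.remainder-small D)
      ... | inj₁ R≈0 = no-proper-divisor D degF d<n R≈0
      ... | inj₂ (e , e<d , degR) = rec e<d (Division.remainder D) degR (ℕ.<-trans e<d d<n)
              (Evalᶜ.remainder-root D α P̂[α]≈0 F[α]≈0)

    -- The counterpart of `small-root⇒zero` at α: minimality carried over from β to a conjugate.
    conjugate-small-root⇒zero : ∀ F → VanishesFrom n F → evalᶜ F α ≈ᶜ ℝ⇒ℂ 0ᵣ → F ≈ₚ []
    conjugate-small-root⇒zero F v F[α]≈0 with zero-or-degree n F v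
    ... | inj₁ F≈0             = F≈0
    ... | inj₂ (d , d<n , deg) = contradiction F[α]≈0 (no-small-degree d F deg d<n)

-- Both polynomials are monic of the same degree, so their difference has smaller degree and still
-- vanishes at β. This identifies the polynomials hidden in `GaloisConjugate` and `IsCofactor` with
-- the given one.
minimal-unique : ∀ {β P Q n} → IsMinimalPolynomial β P → HasDegree P n → IsMinimalPolynomial β Q → Q ≈ₚ P
minimal-unique {β} {P} {Q} {n} minP degP minQ i = begin
  coeff Q i                          ≡⟨ solve 2 (λ p q → q := p :- (p :+ (:- con 1ℚ) :* q)) refl
                                          (coeff P i) (coeff Q i) ⟩
  coeff P i - (coeff P i + - 1ℚ * coeff Q i)  ≡⟨ cong (λ t → coeff P i - t) (sym (coeff-F i)) ⟩
  coeff P i - coeff F i              ≡⟨ cong (λ t → coeff P i - t) (MP.small-root⇒zero F F-small F-root i) ⟩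
  coeff P i - 0ℚ                     ≡⟨ ℚ.+-identityʳ (coeff P i) ⟩
  coeff P i                          ∎
  where
  open ≡-Reasoning
  module MP = Minimal {β} {P} minP degP
  F = P +ₚ map (- 1ℚ *_) Q

  degQ : HasDegree Q n
  degQ with d , deg , _ ← IsMinimalPolynomial.monic minQ = subst (HasDegree Q)
    (ℕ.≤-antisym (IsMinimalPolynomial.minimal minQ P d n deg degP (IsMinimalPolynomial.root minP))
                 (IsMinimalPolynomial.minimal minP Q n d degP deg (IsMinimalPolynomial.root minQ)))
    deg
  module MQ = Minimal {β} {Q} minQ degQ

  coeff-F : ∀ i → coeff F i ≡ coeff P i + - 1ℚ * coeff Q i
  coeff-F i = trans (coeff-+ₚ P (map (- 1ℚ *_) Q) i) (cong (coeff P i +_) (coeff-scale (- 1ℚ) Q i))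

  F-small : VanishesFrom n F
  F-small = vanishes-below n F
    (λ i n<i → trans (coeff-F i) (cong₂ (λ p q → p + - 1ℚ * q) (proj₂ degP i n<i) (proj₂ degQ i n<i)))
    (trans (coeff-F n) (cong₂ (λ p q → p + - 1ℚ * q) MP.leading MQ.leading))

  F-root : evalᵣ F β ≈ᵣ 0ᵣ
  F-root = ≈ᵣ-trans (evalᵣ F β) (evalᵣ P β +ᵣ evalᵣ (map (- 1ℚ *_) Q) β) 0ᵣ
    (Evalᵣ.eval-+ P (map (- 1ℚ *_) Q) β)
    (+ᵣ-cong {evalᵣ P β} {0ᵣ} {evalᵣ (map (- 1ℚ *_) Q) β} {0ᵣ} (IsMinimalPolynomial.root minP)
      (≈ᵣ-trans (evalᵣ (map (- 1ℚ *_) Q) β) (ℚ⇒ℝ (- 1ℚ) *ᵣ evalᵣ Q β) 0ᵣ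
        (Evalᵣ.eval-scale (- 1ℚ) Q β)
        (*ᵣ-congˡ (ℚ⇒ℝ (- 1ℚ)) {evalᵣ Q β} {0ᵣ} (IsMinimalPolynomial.root minQ))))

-- P and its reversal share the conjugate on the unit circle, where conj α = 1/α.
salem-reciprocal : ∀ {β P} → IsSalem β → IsMinimalPolynomial β P → HasDegree P 6 →
                   ∀ i → i ℕ.≤ 6 → coeff P (6 ℕ.∸ i) ≡ coeff P 0 * coeff P i
salem-reciprocal {β} {P} salem minP degP = reciprocal (IsSalem.conjugate≡1 salem)
  where
  open Minimal {β} {P} minP degP
  P̂ = applyUpTo (coeff P) 7
  -- The reversal has top coefficient p₀ and `P̂` is monic, so the multiple p₀ cancels the term of
  -- degree 6.
  D = reverse P̂ +ₚ map (- coeff P 0 *_) P̂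

  D-small : VanishesFrom 6 D
  D-small = vanishes-below 6 D (λ i → coeff-beyond-length D i)
    (trans (cong (λ l → coeff P 0 + - coeff P 0 * l) leading)
      (solve 1 (λ p → p :+ (:- p) :* con 1ℚ := con 0ℚ) refl (coeff P 0)))

  reciprocal : ∃[ α ] (OtherGaloisConjugate β α × ∣ α ∣² ≈ᵣ 1ᵣ) →
               ∀ i → i ℕ.≤ 6 → coeff P (6 ℕ.∸ i) ≡ coeff P 0 * coeff P i
  reciprocal (α , ((P′ , minP′ , P′[α]≈0) , _) , ∣α∣²≈1) = compare
    where
    module ℂᶜ = CommutativeRing ℂ-commutativeRing
    P[α]≈0 : evalᶜ P α ≈ᶜ ℝ⇒ℂ 0ᵣ
    P[α]≈0 = ℂᶜ.trans {evalᶜ P α} {evalᶜ P′ α} {ℝ⇒ℂ 0ᵣ}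
      (Evalᶜ.eval-cong P P′ α (λ i → sym (minimal-unique {β} {P} {P′} minP degP minP′ i))) P′[α]≈0

    reversed-root : evalᶜ (reverse P̂) α ≈ᶜ ℝ⇒ℂ 0ᵣ
    reversed-root = Evalᶜ.reverse-root P̂ α (conj α) (z*conj α ∣α∣²≈1)
      (conj-root P̂ α (P̂[α]≈0 {α} P[α]≈0))

    D[α]≈0 : evalᶜ D α ≈ᶜ ℝ⇒ℂ 0ᵣ
    D[α]≈0 = ℂᶜ.trans {evalᶜ D α} {evalᶜ (reverse P̂) α ℂᶜ.+ evalᶜ -p₀P̂ α} {ℝ⇒ℂ 0ᵣ}
      (Evalᶜ.eval-+ (reverse P̂) -p₀P̂ α)
      (ℂᶜ.trans {evalᶜ (reverse P̂) α ℂᶜ.+ evalᶜ -p₀P̂ α} {ℝ⇒ℂ 0ᵣ ℂᶜ.+ ℝ⇒ℂ 0ᵣ} {ℝ⇒ℂ 0ᵣ}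
        (ℂᶜ.+-cong {evalᶜ (reverse P̂) α} {ℝ⇒ℂ 0ᵣ} {evalᶜ -p₀P̂ α} {ℝ⇒ℂ 0ᵣ} reversed-root
          (ℂᶜ.trans {evalᶜ -p₀P̂ α} {ι ℂᶜ.* evalᶜ P̂ α} {ℝ⇒ℂ 0ᵣ} (Evalᶜ.eval-scale (- coeff P 0) P̂ α)
            (ℂᶜ.trans {ι ℂᶜ.* evalᶜ P̂ α} {ι ℂᶜ.* ℝ⇒ℂ 0ᵣ} {ℝ⇒ℂ 0ᵣ}
              (ℂᶜ.*-cong {ι} {ι} {evalᶜ P̂ α} {ℝ⇒ℂ 0ᵣ} (ℂᶜ.refl {ι}) (P̂[α]≈0 {α} P[α]≈0))
              (ℂᶜ.zeroʳ ι))))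
        (ℂᶜ.+-identityˡ (ℝ⇒ℂ 0ᵣ)))
      where
      -p₀P̂ = map (- coeff P 0 *_) P̂
      ι = ℝ⇒ℂ (ℚ⇒ℝ (- coeff P 0))

    p+-q*r≡0⇒p≡q*r : ∀ p q r → p + - q * r ≡ 0ℚ → p ≡ q * r
    p+-q*r≡0⇒p≡q*r p q r eq = trans
      (solve 3 (λ p q r → p := p :+ (:- q) :* r :+ q :* r) refl p q r)
      (trans (cong (_+ q * r) eq) (ℚ.+-identityˡ (q * r)))

    compare : ∀ i → i ℕ.≤ 6 → coeff P (6 ℕ.∸ i) ≡ coeff P 0 * coeff P i
    compare i i≤6 = p+-q*r≡0⇒p≡q*r (coeff P (6 ℕ.∸ i)) (coeff P 0) (coeff P i)
      (trans (coeff-D i i≤6) (conjugate-small-root⇒zero {α} P[α]≈0 D D-small D[α]≈0 i))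
      where
      coeff-D : ∀ i → i ℕ.≤ 6 → coeff P (6 ℕ.∸ i) + - coeff P 0 * coeff P i ≡ coeff D i
      coeff-D 0 _ = refl
      coeff-D 1 _ = refl
      coeff-D 2 _ = refl
      coeff-D 3 _ = refl
      coeff-D 4 _ = refl
      coeff-D 5 _ = refl
      coeff-D 6 _ = refl
      coeff-D (suc (suc (suc (suc (suc (suc (suc _)))))))
        (s≤s (s≤s (s≤s (s≤s (s≤s (s≤s ()))))))

-- Greedy expansions

0≤ℤ⇒ℚ-difference : ∀ {k l} → k ℤ.≤ l → 0ℚ ≤ ℤ⇒ℚ l - ℤ⇒ℚ k
0≤ℤ⇒ℚ-difference {k} {l} k≤l = subst (_≤ ℤ⇒ℚ l - ℤ⇒ℚ k) (ℚ.+-inverseʳ (ℤ⇒ℚ k))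
  (ℚ.+-monoˡ-≤ (- ℤ⇒ℚ k) (ℤ⇒ℚ-mono-≤ k≤l))

0≤ℤ⇒ℚ-difference-1 : ∀ {k l} → k ℤ.< l → 0ℚ ≤ ℤ⇒ℚ l - (ℤ⇒ℚ k + 1ℚ)
0≤ℤ⇒ℚ-difference-1 {k} {l} k<l = subst (λ q → 0ℚ ≤ ℤ⇒ℚ l - q)
  (trans (ℤ⇒ℚ-homo-+ 1ℤ k) (ℚ.+-comm 1ℚ (ℤ⇒ℚ k))) (0≤ℤ⇒ℚ-difference (ℤ.i<j⇒suc[i]≤j k<l))

≈ᵣ⇒≮ᵣ : ∀ x y → x ≈ᵣ y → ¬ y <ᵣ x
≈ᵣ⇒≮ᵣ x y x≈y y<x = ¬Pos0 (Pos-resp-≈ (x -ᵣ y) 0ᵣ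
  (≈ᵣ-trans (x -ᵣ y) (y -ᵣ y) 0ᵣ (+ᵣ-cong {x} {y} { -ᵣ y} { -ᵣ y} x≈y (≈ᵣ-refl (-ᵣ y)))
    (pointwise (y -ᵣ y) 0ᵣ λ n → ℚ.+-inverseʳ (seq y n)))
  (<ᵣ⇒Pos y x y<x))

-- If l < k, then l + 1 ≤ k, so (k - x) + (x - y) = k - y is at least (l + 1) - y > 0. `Pos-split`
-- then gives x < k or y < x, and both are excluded.
floor-mono : ∀ x y {k l} → ¬ y <ᵣ x → IsFloor x k → IsFloor y l → k ℤ.≤ l
floor-mono x y {k} {l} y≮x (x≮k , _) (_ , y<l+1) = ℤ.≮⇒≥ λ l<k →
  [ (λ k-x>0 → x≮k (Pos⇒<ᵣ x (ℤ⇒ℝ k) k-x>0)) , (λ x-y>0 → y≮x (Pos⇒<ᵣ y x x-y>0)) ]′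
    (Pos-split (ℤ⇒ℝ k -ᵣ x) (x -ᵣ y)
      (Pos-resp-≈ (l+1 -ᵣ y +ᵣ ℚ⇒ℝ (gap l<k)) (ℤ⇒ℝ k -ᵣ x +ᵣ (x -ᵣ y))
        (pointwise (l+1 -ᵣ y +ᵣ ℚ⇒ℝ (gap l<k)) (ℤ⇒ℝ k -ᵣ x +ᵣ (x -ᵣ y)) λ n →
          solve 4 (λ l y k x → l :+ con 1ℚ :- y :+ (k :- (l :+ con 1ℚ)) := k :- x :+ (x :- y)) refl
            (ℤ⇒ℚ l) (seq y n) (ℤ⇒ℚ k) (seq x n))
        (Pos-+-ℚ (l+1 -ᵣ y) (<ᵣ⇒Pos y l+1 y<l+1) (0≤ℤ⇒ℚ-difference-1 l<k))))
  where
  l+1 = ℤ⇒ℝ l +ᵣ 1ᵣ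
  gap : l ℤ.< k → ℚ
  gap _ = ℤ⇒ℚ k - (ℤ⇒ℚ l + 1ℚ)

floor-unique : ∀ x y {k l} → x ≈ᵣ y → IsFloor x k → IsFloor y l → k ≡ l
floor-unique x y x≈y fx fy = ℤ.≤-antisym
  (floor-mono x y (≈ᵣ⇒≮ᵣ x y x≈y) fx fy)
  (floor-mono y x (≈ᵣ⇒≮ᵣ y x (≈ᵣ-sym x y x≈y)) fy fx)

ℤ⇒ℝ-floor : ∀ k → IsFloor (ℤ⇒ℝ k) k
ℤ⇒ℝ-floor k = ≈ᵣ⇒≮ᵣ (ℤ⇒ℝ k) (ℤ⇒ℝ k) (≈ᵣ-refl (ℤ⇒ℝ k)) ,
  Pos⇒<ᵣ (ℤ⇒ℝ k) (ℤ⇒ℝ k +ᵣ 1ᵣ) (Pos-resp-≈ 1ᵣ (ℤ⇒ℝ k +ᵣ 1ᵣ -ᵣ ℤ⇒ℝ k)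
    (pointwise 1ᵣ (ℤ⇒ℝ k +ᵣ 1ᵣ -ᵣ ℤ⇒ℝ k) λ _ →
      solve 1 (λ k → con 1ℚ := k :+ con 1ℚ :- k) refl (ℤ⇒ℚ k))
    (Pos-ℚ 0<1))

1<⇒Pos : ∀ β → 1ᵣ <ᵣ β → Pos β
1<⇒Pos β 1<β = Pos-resp-≈ (β -ᵣ 1ᵣ +ᵣ 1ᵣ) β
  (pointwise (β -ᵣ 1ᵣ +ᵣ 1ᵣ) β λ n → solve 1 (λ b → b :- con 1ℚ :+ con 1ℚ := b) refl (seq β n))
  (Pos-+-ℚ (β -ᵣ 1ᵣ) (<ᵣ⇒Pos 1ᵣ β 1<β) (ℚ.<⇒≤ 0<1))

greedy-step-cong : ∀ β {x y k l} → x ≈ᵣ y → k ≡ l → β *ᵣ x -ᵣ ℤ⇒ℝ k ≈ᵣ β *ᵣ y -ᵣ ℤ⇒ℝ l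
greedy-step-cong β {x} {y} {k} x≈y refl =
  +ᵣ-cong {β *ᵣ x} {β *ᵣ y} { -ᵣ ℤ⇒ℝ k} { -ᵣ ℤ⇒ℝ k} (*ᵣ-congˡ β {x} {y} x≈y) (≈ᵣ-refl (-ᵣ ℤ⇒ℝ k))

module Greedy {β c} (1<β : 1ᵣ <ᵣ β) (greedy : IsGreedyExpansion β c) where
  open IsGreedyExpansion greedy

  private
    β>0 : Pos β
    β>0 = 1<⇒Pos β 1<β

  remainder-difference : ∀ i j → r (suc i) -ᵣ r (suc j) ≈ᵣ
                            β *ᵣ (r i -ᵣ r j) +ᵣ (ℤ⇒ℝ (c (suc j)) -ᵣ ℤ⇒ℝ (c (suc i)))
  remainder-difference i j = ≈ᵣ-trans (r (suc i) -ᵣ r (suc j)) (u -ᵣ v)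
    (β *ᵣ (r i -ᵣ r j) +ᵣ (ℤ⇒ℝ (c (suc j)) -ᵣ ℤ⇒ℝ (c (suc i))))
    (+ᵣ-cong {r (suc i)} {u} { -ᵣ r (suc j)} { -ᵣ v} (step i) (-ᵣ-cong {r (suc j)} {v} (step j)))
    (pointwise (u -ᵣ v) (β *ᵣ (r i -ᵣ r j) +ᵣ (ℤ⇒ℝ (c (suc j)) -ᵣ ℤ⇒ℝ (c (suc i)))) λ n →
      solve 5 (λ b x y k l → b :* x :- k :- (b :* y :- l) := b :* (x :- y) :+ (l :- k)) refl
        (seq β n) (seq (r i) n) (seq (r j) n) (ℤ⇒ℚ (c (suc i))) (ℤ⇒ℚ (c (suc j))))
    where
    u = β *ᵣ r i -ᵣ ℤ⇒ℝ (c (suc i))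
    v = β *ᵣ r j -ᵣ ℤ⇒ℝ (c (suc j))

  remainder≮0 : ∀ n → ¬ Pos (-ᵣ r (suc n))
  remainder≮0 n r<0 = proj₁ (digit n) (Pos⇒<ᵣ (β *ᵣ r n) cₙ
    (Pos-resp-≈ (-ᵣ r (suc n)) (cₙ -ᵣ β *ᵣ r n)
      (≈ᵣ-trans (-ᵣ r (suc n)) (-ᵣ (β *ᵣ r n -ᵣ cₙ)) (cₙ -ᵣ β *ᵣ r n)
        (-ᵣ-cong {r (suc n)} {β *ᵣ r n -ᵣ cₙ} (step n))
        (pointwise (-ᵣ (β *ᵣ r n -ᵣ cₙ)) (cₙ -ᵣ β *ᵣ r n) λ m →
          solve 2 (λ x k → :- (x :- k) := k :- x) refl (seq (β *ᵣ r n) m) (ℤ⇒ℚ (c (suc n)))))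
      r<0))
    where cₙ = ℤ⇒ℝ (c (suc n))

  remainder<1 : ∀ n → Pos (1ᵣ -ᵣ r (suc n))
  remainder<1 n = Pos-resp-≈ (cₙ +ᵣ 1ᵣ -ᵣ β *ᵣ r n) (1ᵣ -ᵣ r (suc n))
    (≈ᵣ-trans (cₙ +ᵣ 1ᵣ -ᵣ β *ᵣ r n) (1ᵣ -ᵣ (β *ᵣ r n -ᵣ cₙ)) (1ᵣ -ᵣ r (suc n))
      (pointwise (cₙ +ᵣ 1ᵣ -ᵣ β *ᵣ r n) (1ᵣ -ᵣ (β *ᵣ r n -ᵣ cₙ)) λ m →
        solve 2 (λ x k → k :+ con 1ℚ :- x := con 1ℚ :- (x :- k)) refl
          (seq (β *ᵣ r n) m) (ℤ⇒ℚ (c (suc n))))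
      (+ᵣ-cong {1ᵣ} {1ᵣ} { -ᵣ (β *ᵣ r n -ᵣ cₙ)} { -ᵣ r (suc n)} (≈ᵣ-refl 1ᵣ)
        (-ᵣ-cong {β *ᵣ r n -ᵣ cₙ} {r (suc n)} (≈ᵣ-sym (r (suc n)) (β *ᵣ r n -ᵣ cₙ) (step n)))))
    (<ᵣ⇒Pos (β *ᵣ r n) (cₙ +ᵣ 1ᵣ) (proj₂ (digit n)))
    where cₙ = ℤ⇒ℝ (c (suc n))

  remainder≤r₀ : ∀ n → ¬ Pos (r n -ᵣ r 0)
  remainder≤r₀ zero    pos = ¬Pos0 (Pos-resp-≈ (r 0 -ᵣ r 0) 0ᵣ
    (pointwise (r 0 -ᵣ r 0) 0ᵣ λ m → ℚ.+-inverseʳ (seq (r 0) m)) pos)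
  remainder≤r₀ (suc n) pos = ≈ᵣ⇒≮ᵣ 1ᵣ (r 0) (≈ᵣ-sym (r 0) 1ᵣ r₀) (Pos⇒<ᵣ (r 0) 1ᵣ
    (Pos-resp-≈ (1ᵣ -ᵣ r (suc n) +ᵣ (r (suc n) -ᵣ r 0)) (1ᵣ -ᵣ r 0)
      (pointwise (1ᵣ -ᵣ r (suc n) +ᵣ (r (suc n) -ᵣ r 0)) (1ᵣ -ᵣ r 0) λ m →
        solve 2 (λ x y → con 1ℚ :- x :+ (x :- y) := con 1ℚ :- y) refl (seq (r (suc n)) m) (seq (r 0) m))
      (Pos-+ (1ᵣ -ᵣ r (suc n)) (r (suc n) -ᵣ r 0) (remainder<1 n) pos)))

  β*-reflects-< : ∀ x y → β *ᵣ y <ᵣ β *ᵣ x → Pos (x -ᵣ y)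
  β*-reflects-< x y βy<βx = Pos-cancelˡ-* β (x -ᵣ y) β>0
    (Pos-resp-≈ (β *ᵣ x -ᵣ β *ᵣ y) (β *ᵣ (x -ᵣ y))
      (pointwise (β *ᵣ x -ᵣ β *ᵣ y) (β *ᵣ (x -ᵣ y)) λ m →
        solve 3 (λ b x y → b :* x :- b :* y := b :* (x :- y)) refl (seq β m) (seq x m) (seq y m))
      (<ᵣ⇒Pos (β *ᵣ y) (β *ᵣ x) βy<βx))

  digit-mono : ∀ i j → ¬ Pos (r i -ᵣ r j) → c (suc i) ℤ.≤ c (suc j)
  digit-mono i j rᵢ≤rⱼ = floor-mono (β *ᵣ r i) (β *ᵣ r j)
    (λ βrⱼ<βrᵢ → rᵢ≤rⱼ (β*-reflects-< (r i) (r j) βrⱼ<βrᵢ)) (digit i) (digit j)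

  -- On equal digits the next remainders differ by β (rᵢ - rⱼ), and β > 0 preserves the order.
  tie : ∀ i j → c (suc i) ≡ c (suc j) → ¬ Pos (r i -ᵣ r j) → ¬ Pos (r (suc i) -ᵣ r (suc j))
  tie i j cᵢ≡cⱼ rᵢ≤rⱼ pos = rᵢ≤rⱼ (Pos-cancelˡ-* β (r i -ᵣ r j) β>0
    (Pos-resp-≈ (r (suc i) -ᵣ r (suc j)) (β *ᵣ (r i -ᵣ r j))
      (≈ᵣ-trans (r (suc i) -ᵣ r (suc j)) (β *ᵣ (r i -ᵣ r j) +ᵣ (cⱼ -ᵣ cᵢ)) (β *ᵣ (r i -ᵣ r j))
        (remainder-difference i j)
        (pointwise (β *ᵣ (r i -ᵣ r j) +ᵣ (cⱼ -ᵣ cᵢ)) (β *ᵣ (r i -ᵣ r j)) λ m →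
          trans (cong (λ k → seq (β *ᵣ (r i -ᵣ r j)) m + (ℤ⇒ℚ (c (suc j)) - ℤ⇒ℚ k)) cᵢ≡cⱼ)
            (solve 2 (λ x k → x :+ (k :- k) := x) refl
              (seq (β *ᵣ (r i -ᵣ r j)) m) (ℤ⇒ℚ (c (suc j))))))
      pos))
    where
    cᵢ = ℤ⇒ℝ (c (suc i))
    cⱼ = ℤ⇒ℝ (c (suc j))

  digit≤c₁ : ∀ n → c (suc n) ℤ.≤ c 1
  digit≤c₁ n = digit-mono n 0 (remainder≤r₀ n)

  -- This is the second place of Parry's condition that no shift of the expansion exceeds it
  -- lexicographically; `digit≤c₁` is the first place.
  digit≡c₁⇒next≤c₂ : ∀ n → c (suc n) ≡ c 1 → c (suc (suc n)) ℤ.≤ c 2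
  digit≡c₁⇒next≤c₂ n cₙ≡c₁ = digit-mono (suc n) 1 (tie n 0 cₙ≡c₁ (remainder≤r₀ n))

  c₂≥0 : 0ℤ ℤ.≤ c 2
  c₂≥0 = floor-mono 0ᵣ (β *ᵣ r 1) βr₁≮0 (ℤ⇒ℝ-floor 0ℤ) (digit 1)
    where
    βr₁≮0 : ¬ β *ᵣ r 1 <ᵣ 0ᵣ
    βr₁≮0 βr₁<0 = remainder≮0 0 (Pos-cancelˡ-* β (-ᵣ r 1) β>0
      (Pos-resp-≈ (0ᵣ -ᵣ β *ᵣ r 1) (β *ᵣ -ᵣ r 1)
        (pointwise (0ᵣ -ᵣ β *ᵣ r 1) (β *ᵣ -ᵣ r 1) λ m →
          solve 2 (λ b x → con 0ℚ :- b :* x := b :* (:- x)) refl (seq β m) (seq (r 1) m))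
        (<ᵣ⇒Pos (β *ᵣ r 1) 0ᵣ βr₁<0)))

  c₁≥1 : 1ℤ ℤ.≤ c 1
  c₁≥1 = floor-mono 1ᵣ (β *ᵣ r 0) βr₀≮1 (ℤ⇒ℝ-floor 1ℤ) (digit 0)
    where
    βr₀≈β : β ≈ᵣ β *ᵣ r 0
    βr₀≈β = ≈ᵣ-trans β (β *ᵣ 1ᵣ) (β *ᵣ r 0)
      (pointwise β (β *ᵣ 1ᵣ) λ m → sym (ℚ.*-identityʳ (seq β m)))
      (*ᵣ-congˡ β {1ᵣ} {r 0} (≈ᵣ-sym (r 0) 1ᵣ r₀))
    βr₀≮1 : ¬ β *ᵣ r 0 <ᵣ 1ᵣ
    βr₀≮1 βr₀<1 = ≈ᵣ⇒≮ᵣ β (β *ᵣ r 0) βr₀≈β (Pos⇒<ᵣ (β *ᵣ r 0) β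
      (Pos-resp-≈ (β -ᵣ 1ᵣ +ᵣ (1ᵣ -ᵣ β *ᵣ r 0)) (β -ᵣ β *ᵣ r 0)
        (pointwise (β -ᵣ 1ᵣ +ᵣ (1ᵣ -ᵣ β *ᵣ r 0)) (β -ᵣ β *ᵣ r 0) λ m →
          solve 2 (λ b y → b :- con 1ℚ :+ (con 1ℚ :- y) := b :- y) refl (seq β m) (seq (β *ᵣ r 0) m))
        (Pos-+ (β -ᵣ 1ᵣ) (1ᵣ -ᵣ β *ᵣ r 0) (<ᵣ⇒Pos 1ᵣ β 1<β) (<ᵣ⇒Pos (β *ᵣ r 0) 1ᵣ βr₀<1))))

greedy-unique : ∀ {β c c′} → IsGreedyExpansion β c → IsGreedyExpansion β c′ →
                ∀ n → c (suc n) ≡ c′ (suc n)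
greedy-unique {β} {c} {c′} g g′ n =
  floor-unique (β *ᵣ r n) (β *ᵣ r′ n) (*ᵣ-congˡ β {r n} {r′ n} (same-remainder n)) (digit n) (digit′ n)
  where
  open IsGreedyExpansion g
  open IsGreedyExpansion g′ renaming (r to r′; r₀ to r′₀; digit to digit′; step to step′)
  same-remainder : ∀ n → r n ≈ᵣ r′ n
  same-remainder zero    = ≈ᵣ-trans (r 0) 1ᵣ (r′ 0) r₀ (≈ᵣ-sym (r′ 0) 1ᵣ r′₀)
  same-remainder (suc n) = ≈ᵣ-trans (r (suc n)) (β *ᵣ r n -ᵣ ℤ⇒ℝ (c (suc n))) (r′ (suc n)) (step n)
    (≈ᵣ-trans (β *ᵣ r n -ᵣ ℤ⇒ℝ (c (suc n))) (β *ᵣ r′ n -ᵣ ℤ⇒ℝ (c′ (suc n))) (r′ (suc n))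
      (greedy-step-cong β {r n} {r′ n} {c (suc n)} {c′ (suc n)} (same-remainder n)
        (floor-unique (β *ᵣ r n) (β *ᵣ r′ n) {c (suc n)} {c′ (suc n)} (*ᵣ-congˡ β {r n} {r′ n} (same-remainder n))
          (digit n) (digit′ n)))
      (≈ᵣ-sym (r′ (suc n)) (β *ᵣ r′ n -ᵣ ℤ⇒ℝ (c′ (suc n))) (step′ n)))

-- Expansions 1, a, b, c, b, a, 0, 0 of preperiod 1 and period 7

digits : ℤ → ℤ → ℤ → ℕ → ℤ
digits a b c 0 = 0ℤ
digits a b c 1 = 1ℤ
digits a b c 2 = a
digits a b c 3 = b
digits a b c 4 = c
digits a b c 5 = b
digits a b c 6 = a
digits a b c 7 = 0ℤ
digits a b c 8 = 0ℤ
-- Index n + 9 falls back to n + 2, so the block c₂, ..., c₈ repeats and c₁ stays outside.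
digits a b c (suc (suc (suc (suc (suc (suc (suc (suc (suc n))))))))) = digits a b c (suc (suc n))

digits≥0 : ∀ {a b c} → 0ℤ ℤ.≤ a → 0ℤ ℤ.≤ b → 0ℤ ℤ.≤ c → ∀ n → 0ℤ ℤ.≤ digits a b c n
digits≥0 a≥0 b≥0 c≥0 0 = ℤ.≤-refl
digits≥0 a≥0 b≥0 c≥0 1 = ℤ.+≤+ z≤n
digits≥0 a≥0 b≥0 c≥0 2 = a≥0
digits≥0 a≥0 b≥0 c≥0 3 = b≥0
digits≥0 a≥0 b≥0 c≥0 4 = c≥0
digits≥0 a≥0 b≥0 c≥0 5 = b≥0
digits≥0 a≥0 b≥0 c≥0 6 = a≥0
digits≥0 a≥0 b≥0 c≥0 7 = ℤ.≤-refl
digits≥0 a≥0 b≥0 c≥0 8 = ℤ.≤-refl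
digits≥0 a≥0 b≥0 c≥0 (suc (suc (suc (suc (suc (suc (suc (suc (suc n))))))))) =
  digits≥0 a≥0 b≥0 c≥0 (suc (suc n))

digits-periodic : ∀ a b c j m → digits a b c (2 ℕ.+ (7 ℕ.* m ℕ.+ j)) ≡ digits a b c (2 ℕ.+ j)
digits-periodic a b c j zero    = refl
digits-periodic a b c j (suc m) = trans
  (cong (λ k → digits a b c (2 ℕ.+ k)) (ℕ-solve 2 (λ m j →
    conⁿ 7 :*ⁿ (conⁿ 1 :+ⁿ m) :+ⁿ j :=ⁿ conⁿ 7 :+ⁿ (conⁿ 7 :*ⁿ m :+ⁿ j)) refl m j))
  (digits-periodic a b c j m)

AperiodicBlock : (ℕ → ℤ) → Set
AperiodicBlock d = ∀ p → 1 ℕ.≤ p → p ℕ.< 7 → ¬ (∀ j → d (2 ℕ.+ j) ≡ d (2 ℕ.+ (j ℕ.+ p)))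

digits-preperiod-period : ∀ a b c → AperiodicBlock (digits a b c) →
                          HasPreperiodAndPeriod (digits a b c) 1 7
digits-preperiod-period a b c aperiodic = record
  { p≥1 = s≤s z≤n ; periodic = periodic ; least = λ m p p≥1 ep → preperiod m p p≥1 ep , period m p p≥1 ep }
  where
  d = digits a b c

  periodic : EventuallyPeriodic d 1 7
  periodic (suc n) _ = trans
    (cong d (ℕ-solve 1 (λ n → conⁿ 1 :+ⁿ n :+ⁿ conⁿ 1 :=ⁿ conⁿ 2 :+ⁿ n) refl n))
    (cong d (ℕ-solve 1 (λ n → conⁿ 9 :+ⁿ n :=ⁿ conⁿ 1 :+ⁿ n :+ⁿ conⁿ 1 :+ⁿ conⁿ 7) refl n))

  preperiod : ∀ m p → 1 ℕ.≤ p → EventuallyPeriodic d m p → 1 ℕ.≤ m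
  preperiod (suc m) _       _ _  = s≤s z≤n
  preperiod zero    (suc p) _ ep =
    -- Pure periodicity would give c₁ = c₁₊ₚ = c₈₊ₚ = c₈ for the period p in question, but c₁ = 1
    -- and c₈ = 0.
    contradiction (trans (ep 1 (s≤s z≤n)) (sym (ep 8 (s≤s z≤n)))) λ ()

  period : ∀ m p → 1 ℕ.≤ p → EventuallyPeriodic d m p → 7 ℕ.≤ p
  -- Taking n = 2 + 6m + j makes the index n + m equal to 2 + 7m + j: it lies past the preperiod m
  -- and has the same digit as 2 + j. A period valid from some point on is thus valid from index 2.
  period m p p≥1 ep = ℕ.≮⇒≥ λ p<7 → aperiodic p p≥1 p<7 λ j →
    trans (sym (digits-periodic a b c j m))
      (trans (cong d (ℕ-solve 2 (λ m j →
          conⁿ 2 :+ⁿ (conⁿ 7 :*ⁿ m :+ⁿ j) :=ⁿ conⁿ 2 :+ⁿ conⁿ 6 :*ⁿ m :+ⁿ j :+ⁿ m) refl m j))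
        (trans (ep (2 ℕ.+ 6 ℕ.* m ℕ.+ j) (s≤s z≤n))
          (trans (cong d (ℕ-solve 3 (λ m j p →
              conⁿ 2 :+ⁿ conⁿ 6 :*ⁿ m :+ⁿ j :+ⁿ m :+ⁿ p :=ⁿ conⁿ 2 :+ⁿ (conⁿ 7 :*ⁿ m :+ⁿ (j :+ⁿ p)))
              refl m j p))
            (digits-periodic a b c (j ℕ.+ p) m))))

-- The digits are prescribed, since the floor of a real is not computable; they are recognised as
-- floors afterwards. The n-th value is Pₙ(β) in Horner form.
orbit : ℝ → (ℕ → ℤ) → ℕ → ℝ
orbit β c zero    = 1ᵣ
orbit β c (suc n) = β *ᵣ orbit β c n -ᵣ ℤ⇒ℝ (c (suc n))

-- The remainders 1 = r₀, r₁, …, r₇ are compared lexicographically through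
-- their digits; only β > 1 and r₈ ≈ r₁ are used, no numerical bounds on β.
module Orbit {β a b c} (1<β : 1ᵣ <ᵣ β) (a≥0 : 0ℤ ℤ.≤ a) (b≥0 : 0ℤ ℤ.≤ b) (c≥0 : 0ℤ ℤ.≤ c)
  (r₈≈r₁ : orbit β (digits a b c) 8 ≈ᵣ orbit β (digits a b c) 1) where

  private
    d = digits a b c
    r = orbit β d

    β>0 : Pos β
    β>0 = 1<⇒Pos β 1<β

  infix 4 _≺_

  _≺_ : ℕ → ℕ → Set
  i ≺ j = Pos (r j -ᵣ r i)

  -- β (rⱼ - rᵢ) is the difference of the next remainders plus the difference of the next digits.
  descend : ∀ i j → Pos (r (suc j) -ᵣ r (suc i) +ᵣ ℚ⇒ℝ (ℤ⇒ℚ (d (suc j)) - ℤ⇒ℚ (d (suc i)))) → i ≺ j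
  descend i j pos = Pos-cancelˡ-* β (r j -ᵣ r i) β>0 (Pos-resp-≈ x (β *ᵣ (r j -ᵣ r i))
    (pointwise x (β *ᵣ (r j -ᵣ r i)) λ n →
      solve 5 (λ β x y k l → β :* y :- l :- (β :* x :- k) :+ (l :- k) := β :* (y :- x)) refl
        (seq β n) (seq (r i) n) (seq (r j) n) (ℤ⇒ℚ (d (suc i))) (ℤ⇒ℚ (d (suc j))))
    pos)
    where x = r (suc j) -ᵣ r (suc i) +ᵣ ℚ⇒ℝ (ℤ⇒ℚ (d (suc j)) - ℤ⇒ℚ (d (suc i)))

  tie≺ : ∀ i j → d (suc i) ℤ.≤ d (suc j) → suc i ≺ suc j → i ≺ j
  tie≺ i j dᵢ≤dⱼ si≺sj = descend i j
    (Pos-+-ℚ (r (suc j) -ᵣ r (suc i)) si≺sj (0≤ℤ⇒ℚ-difference dᵢ≤dⱼ))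

  -- A digit gap of at least 1 outweighs the remainders, since 1 - rᵢ₊₁ and rⱼ₊₁ are both positive.
  drop≺ : ∀ i j → d (suc i) ℤ.< d (suc j) → suc i ≺ 0 → Pos (r (suc j)) → i ≺ j
  drop≺ i j dᵢ<dⱼ si≺0 rⱼ>0 = descend i j (Pos-resp-≈ x y
    (pointwise x y λ n →
      solve 4 (λ x y k l → con 1ℚ :- x :+ y :+ (l :- (k :+ con 1ℚ)) := y :- x :+ (l :- k)) refl
        (seq (r (suc i)) n) (seq (r (suc j)) n) (ℤ⇒ℚ (d (suc i))) (ℤ⇒ℚ (d (suc j))))
    (Pos-+-ℚ (1ᵣ -ᵣ r (suc i) +ᵣ r (suc j)) (Pos-+ (1ᵣ -ᵣ r (suc i)) (r (suc j)) si≺0 rⱼ>0)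
      (0≤ℤ⇒ℚ-difference-1 dᵢ<dⱼ)))
    where
    x = 1ᵣ -ᵣ r (suc i) +ᵣ r (suc j) +ᵣ ℚ⇒ℝ (ℤ⇒ℚ (d (suc j)) - (ℤ⇒ℚ (d (suc i)) + 1ℚ))
    y = r (suc j) -ᵣ r (suc i) +ᵣ ℚ⇒ℝ (ℤ⇒ℚ (d (suc j)) - ℤ⇒ℚ (d (suc i)))

  -- β rₙ = rₙ₊₁ + dₙ₊₁ with a nonnegative digit, so positivity travels backwards; it starts from r₈
  -- ≈ r₁ = β - 1.
  positive-back : ∀ n → Pos (r (suc n)) → Pos (r n)
  positive-back n pos = Pos-cancelˡ-* β (r n) β>0 (Pos-resp-≈ x (β *ᵣ r n)
    (pointwise x (β *ᵣ r n) λ m →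
      solve 2 (λ x k → x :- k :+ k := x) refl (seq (β *ᵣ r n) m) (ℤ⇒ℚ (d (suc n))))
    (Pos-+-ℚ (r (suc n)) pos (ℤ⇒ℚ-mono-≤ (digits≥0 a≥0 b≥0 c≥0 (suc n)))))
    where x = r (suc n) +ᵣ ℤ⇒ℝ (d (suc n))

  r₁>0 : Pos (r 1)
  r₁>0 = Pos-resp-≈ (β -ᵣ 1ᵣ) (r 1)
    (pointwise (β -ᵣ 1ᵣ) (r 1) λ m → cong (_- 1ℚ) (sym (ℚ.*-identityʳ (seq β m))))
    (<ᵣ⇒Pos 1ᵣ β 1<β)

  r₇>0 : Pos (r 7)
  r₇>0 = positive-back 7 (Pos-resp-≈ (r 1) (r 8) (≈ᵣ-sym (r 8) (r 1) r₈≈r₁) r₁>0)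

  r₆>0 : Pos (r 6)
  r₆>0 = positive-back 6 r₇>0

  r₅>0 : Pos (r 5)
  r₅>0 = positive-back 5 r₆>0

  r₄>0 : Pos (r 4)
  r₄>0 = positive-back 4 r₅>0

  r₃>0 : Pos (r 3)
  r₃>0 = positive-back 3 r₄>0

  r₂>0 : Pos (r 2)
  r₂>0 = positive-back 2 r₃>0

  -- β (r₀ - r₇) = r₁ - r₈ + 1 = 1; every other comparison reduces to this one.
  7≺0 : 7 ≺ 0
  7≺0 = descend 7 0 (Pos-resp-≈ (r 1 -ᵣ r 1 +ᵣ 1ᵣ) (r 1 -ᵣ r 8 +ᵣ 1ᵣ)
    (+ᵣ-cong {r 1 -ᵣ r 1} {r 1 -ᵣ r 8} {1ᵣ} {1ᵣ}
      (+ᵣ-cong {r 1} {r 1} { -ᵣ r 1} { -ᵣ r 8} (≈ᵣ-refl (r 1))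
        (-ᵣ-cong {r 1} {r 8} (≈ᵣ-sym (r 8) (r 1) r₈≈r₁)))
      (≈ᵣ-refl 1ᵣ))
    (Pos-resp-≈ 1ᵣ (r 1 -ᵣ r 1 +ᵣ 1ᵣ)
      (pointwise 1ᵣ (r 1 -ᵣ r 1 +ᵣ 1ᵣ) λ m →
        solve 1 (λ x → con 1ℚ := x :- x :+ con 1ℚ) refl (seq (r 1) m))
      (Pos-ℚ 0<1)))

  orbit-periodic : ∀ n → r (8 ℕ.+ n) ≈ᵣ r (1 ℕ.+ n)
  orbit-periodic zero    = r₈≈r₁
  orbit-periodic (suc n) = greedy-step-cong β {r (8 ℕ.+ n)} {r (1 ℕ.+ n)} {d (9 ℕ.+ n)} {d (2 ℕ.+ n)}
    (orbit-periodic n) refl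

  greedy : 1 ≺ 0 → 2 ≺ 0 → 3 ≺ 0 → 4 ≺ 0 → 5 ≺ 0 → 6 ≺ 0 → IsGreedyExpansion β d
  greedy 1≺0 2≺0 3≺0 4≺0 5≺0 6≺0 = record
    { r = r ; r₀ = ≈ᵣ-refl 1ᵣ ; digit = digit ; step = λ n → ≈ᵣ-refl (r (suc n)) }
    where
    bounds : ∀ n → Pos (r (suc n)) × suc n ≺ 0
    bounds 0 = r₁>0 , 1≺0
    bounds 1 = r₂>0 , 2≺0
    bounds 2 = r₃>0 , 3≺0
    bounds 3 = r₄>0 , 4≺0
    bounds 4 = r₅>0 , 5≺0
    bounds 5 = r₆>0 , 6≺0
    bounds 6 = r₇>0 , 7≺0
    bounds (suc (suc (suc (suc (suc (suc (suc n))))))) =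
      Pos-resp-≈ (r (1 ℕ.+ n)) (r (8 ℕ.+ n)) r≈ (proj₁ (bounds n)) ,
      Pos-resp-≈ (1ᵣ -ᵣ r (1 ℕ.+ n)) (1ᵣ -ᵣ r (8 ℕ.+ n))
        (+ᵣ-cong {1ᵣ} {1ᵣ} { -ᵣ r (1 ℕ.+ n)} { -ᵣ r (8 ℕ.+ n)} (≈ᵣ-refl 1ᵣ)
          (-ᵣ-cong {r (1 ℕ.+ n)} {r (8 ℕ.+ n)} r≈))
        (proj₂ (bounds n))
      where r≈ = ≈ᵣ-sym (r (8 ℕ.+ n)) (r (1 ℕ.+ n)) (orbit-periodic n)

    digit : ∀ n → IsFloor (β *ᵣ r n) (d (suc n))
    digit n =
      (λ βr<d → ¬Pos0 (Pos-resp-≈ (dₙ -ᵣ βr +ᵣ r (suc n)) 0ᵣ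
        (pointwise (dₙ -ᵣ βr +ᵣ r (suc n)) 0ᵣ λ m →
          solve 2 (λ x k → k :- x :+ (x :- k) := con 0ℚ) refl (seq βr m) (ℤ⇒ℚ (d (suc n))))
        (Pos-+ (dₙ -ᵣ βr) (r (suc n)) (<ᵣ⇒Pos βr dₙ βr<d) (proj₁ (bounds n))))) ,
      Pos⇒<ᵣ βr (dₙ +ᵣ 1ᵣ) (Pos-resp-≈ (1ᵣ -ᵣ r (suc n)) (dₙ +ᵣ 1ᵣ -ᵣ βr)
        (pointwise (1ᵣ -ᵣ r (suc n)) (dₙ +ᵣ 1ᵣ -ᵣ βr) λ m →
          solve 2 (λ x k → con 1ℚ :- (x :- k) := k :+ con 1ℚ :- x) refl (seq βr m) (ℤ⇒ℚ (d (suc n))))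
        (proj₂ (bounds n)))
      where
      dₙ = ℤ⇒ℝ (d (suc n))
      βr = β *ᵣ r n

-- The co-factor identity P₈ - P₁ = P · (x² - x + 1), evaluated at x.
closing-identity : ∀ x a b →
  x * (x * (x * (x * (x * (x * (x * (x * 1ℚ - 1ℚ) - a) - b) - (1ℚ + a - b)) - b) - a) - 0ℚ) - 0ℚ
  ≡ (1ℚ + x * (0ℚ + x * (- (1ℚ + a) + x * (- (1ℚ + a + b) + x * (- (1ℚ + a) + x * (0ℚ + x * (1ℚ + x * 0ℚ)))))))
      * (x * x - x + 1ℚ) + (x * 1ℚ - 1ℚ)
closing-identity = solve 3 (λ x a b →
  x :* (x :* (x :* (x :* (x :* (x :* (x :* (x :* con 1ℚ :- con 1ℚ) :- a) :- b)
    :- (con 1ℚ :+ a :- b)) :- b) :- a) :- con 0ℚ) :- con 0ℚ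
  := (con 1ℚ :+ x :* (con 0ℚ :+ x :* (:- (con 1ℚ :+ a) :+ x :* (:- (con 1ℚ :+ a :+ b)
      :+ x :* (:- (con 1ℚ :+ a) :+ x :* (con 0ℚ :+ x :* (con 1ℚ :+ x :* con 0ℚ)))))))
      :* (x :* x :- x :+ con 1ℚ) :+ (x :* con 1ℚ :- con 1ℚ)) refl

cofactor : ℤ[x]
cofactor = 1ℤ ∷ -1ℤ ∷ 1ℤ ∷ []

-- The parameters are the digits c₂ and c₃: for c₁ = 1 the coefficients are p₁ = 0, p₂ = -(1 + c₂)
-- and p₃ = -(1 + c₂ + c₃).
sextic : ℤ → ℤ → ℤ[x]
sextic a b = 1ℤ ∷ 0ℤ ∷ ℤ.- (1ℤ ℤ.+ a) ∷ ℤ.- (1ℤ ℤ.+ a ℤ.+ b) ∷ ℤ.- (1ℤ ℤ.+ a) ∷ 0ℤ ∷ 1ℤ ∷ []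

-- From the polynomial to the expansion

-- The identity says P₈(β) - P₁(β) = P(β) (β² - β + 1), and P(β) vanishes.
orbit-closes : ∀ {β P L d} → IsMinimalPolynomial β P → P ≈ₚ L →
  (∀ n → seq (orbit β d 8) n
       ≡ seq (evalᵣ L β) n * (seq β n * seq β n - seq β n + 1ℚ) + seq (orbit β d 1) n) →
  orbit β d 8 ≈ᵣ orbit β d 1
orbit-closes {β} {P} {L} {d} minP P≈L identity =
  ≈ᵣ-trans (orbit β d 8) (q *ᵣ evalᵣ L β +ᵣ orbit β d 1) (orbit β d 1)
    (pointwise (orbit β d 8) (q *ᵣ evalᵣ L β +ᵣ orbit β d 1) λ n → trans (identity n)
      (cong (_+ seq (orbit β d 1) n) (ℚ.*-comm (seq (evalᵣ L β) n) (seq q n))))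
    (≈ᵣ-trans (q *ᵣ evalᵣ L β +ᵣ orbit β d 1) (q *ᵣ 0ᵣ +ᵣ orbit β d 1) (orbit β d 1)
      (+ᵣ-cong {q *ᵣ evalᵣ L β} {q *ᵣ 0ᵣ} {orbit β d 1} {orbit β d 1}
        (*ᵣ-congˡ q {evalᵣ L β} {0ᵣ} L[β]≈0) (≈ᵣ-refl (orbit β d 1)))
      (pointwise (q *ᵣ 0ᵣ +ᵣ orbit β d 1) (orbit β d 1) λ n →
        solve 2 (λ q x → q :* con 0ℚ :+ x := x) refl (seq q n) (seq (orbit β d 1) n)))
  where
  q = β *ᵣ β -ᵣ β +ᵣ 1ᵣ
  L[β]≈0 : evalᵣ L β ≈ᵣ 0ᵣ
  L[β]≈0 = ≈ᵣ-trans (evalᵣ L β) (evalᵣ P β) 0ᵣ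
    (≈ᵣ-sym (evalᵣ P β) (evalᵣ L β) (Evalᵣ.eval-cong P L β P≈L)) (IsMinimalPolynomial.root minP)

-- The factorisation is asked for as equality of lists because it then holds by `refl` for concrete
-- digits.
expansion⇒cofactor : ∀ {β P L c} → IsSalem β → IsMinimalPolynomial β P → P ≈ₚ L →
  IsGreedyExpansion β c → HasPreperiodAndPeriod c 1 7 →
  ℤ[x]⇒ℚ[x] (companion c 1 7) ≡ L *ₚ ℤ[x]⇒ℚ[x] cofactor →
  SalemParry 1 7 β × SalemWithCofactor cofactor β
expansion⇒cofactor {β} {P} {L} {c} salem minP P≈L greedy per eq =
  (salem , c , greedy , per) ,
  (salem , c , 1 , 7 , P , greedy , per , minP , λ i →
    trans (cong (λ F → coeff F i) eq) (sym (*ₚ-congʳ {P} {L} (ℤ[x]⇒ℚ[x] cofactor) P≈L i)))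

0ᶻ<1 : 0ℤ ℤ.< 1ℤ
0ᶻ<1 = ℤ.+<+ (s≤s z≤n)

module _ {β : ℝ} {P : ℚ[x]} (salem : IsSalem β) (minP : IsMinimalPolynomial β P) where
  open IsSalem salem using (β>1)

  sextic₀₀⇒expansion : P ≈ₚ ℤ[x]⇒ℚ[x] (sextic 0ℤ 0ℤ) → SalemParry 1 7 β × SalemWithCofactor cofactor β
  sextic₀₀⇒expansion P≈L = expansion⇒cofactor {β} {P} salem minP P≈L
    (greedy 1≺0 2≺0 3≺0 4≺0 5≺0 6≺0)
    (digits-preperiod-period 0ℤ 0ℤ 1ℤ aperiodic) refl
    where
    r₈≈r₁ : orbit β (digits 0ℤ 0ℤ 1ℤ) 8 ≈ᵣ orbit β (digits 0ℤ 0ℤ 1ℤ) 1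
    r₈≈r₁ = orbit-closes {β} {P} {ℤ[x]⇒ℚ[x] (sextic 0ℤ 0ℤ)} {digits 0ℤ 0ℤ 1ℤ} minP P≈L
      -- Orbit and evaluation unfold at index n to exactly the Horner forms of this identity.
      λ n → closing-identity (seq β n) 0ℚ 0ℚ

    open Orbit {β} {0ℤ} {0ℤ} {1ℤ} β>1 ℤ.≤-refl ℤ.≤-refl (ℤ.<⇒≤ 0ᶻ<1) r₈≈r₁

    -- The shift starting at c₄ = 1 agrees with c₁ c₂ c₃ = 1 0 0 on its first three digits; c₇ = 0 <
    -- 1 = c₄ decides.
    4≺1 : 4 ≺ 1
    4≺1 = tie≺ 4 1 ℤ.≤-refl (tie≺ 5 2 ℤ.≤-refl (drop≺ 6 3 0ᶻ<1 7≺0 r₄>0))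
    6≺0 : 6 ≺ 0
    6≺0 = drop≺ 6 0 0ᶻ<1 7≺0 r₁>0
    5≺0 : 5 ≺ 0
    5≺0 = drop≺ 5 0 0ᶻ<1 6≺0 r₁>0
    4≺0 : 4 ≺ 0
    4≺0 = drop≺ 4 0 0ᶻ<1 5≺0 r₁>0
    3≺0 : 3 ≺ 0
    3≺0 = tie≺ 3 0 ℤ.≤-refl 4≺1
    2≺0 : 2 ≺ 0
    2≺0 = drop≺ 2 0 0ᶻ<1 3≺0 r₁>0
    1≺0 : 1 ≺ 0
    1≺0 = drop≺ 1 0 0ᶻ<1 2≺0 r₁>0

    aperiodic : AperiodicBlock (digits 0ℤ 0ℤ 1ℤ)
    -- The block 0 0 1 0 0 0 0 contains a single 1, so no shift by fewer than seven places preserves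
    -- it.
    aperiodic 1 _ _ e = contradiction (e 2) λ ()
    aperiodic 2 _ _ e = contradiction (e 2) λ ()
    aperiodic 3 _ _ e = contradiction (e 2) λ ()
    aperiodic 4 _ _ e = contradiction (e 2) λ ()
    aperiodic 5 _ _ e = contradiction (e 2) λ ()
    aperiodic 6 _ _ e = contradiction (e 2) λ ()
    aperiodic (suc (suc (suc (suc (suc (suc (suc _)))))))
      _ (s≤s (s≤s (s≤s (s≤s (s≤s (s≤s (s≤s ()))))))) _

  sextic₀₁⇒expansion : P ≈ₚ ℤ[x]⇒ℚ[x] (sextic 0ℤ 1ℤ) → SalemParry 1 7 β × SalemWithCofactor cofactor β
  sextic₀₁⇒expansion P≈L = expansion⇒cofactor {β} {P} salem minP P≈L
    (greedy 1≺0 2≺0 3≺0 4≺0 5≺0 6≺0)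
    (digits-preperiod-period 0ℤ 1ℤ 0ℤ aperiodic) refl
    where
    r₈≈r₁ : orbit β (digits 0ℤ 1ℤ 0ℤ) 8 ≈ᵣ orbit β (digits 0ℤ 1ℤ 0ℤ) 1
    r₈≈r₁ = orbit-closes {β} {P} {ℤ[x]⇒ℚ[x] (sextic 0ℤ 1ℤ)} {digits 0ℤ 1ℤ 0ℤ} minP P≈L
      λ n → closing-identity (seq β n) 0ℚ 1ℚ

    open Orbit {β} {0ℤ} {1ℤ} {0ℤ} β>1 ℤ.≤-refl (ℤ.<⇒≤ 0ᶻ<1) ℤ.≤-refl r₈≈r₁

    -- The shifts by two and by four places begin with the digit 1 again. They are decided where c₇
    -- = 0 meets c₅ = 1 and c₃ = 1 respectively.
    5≺1 : 5 ≺ 1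
    5≺1 = tie≺ 5 1 ℤ.≤-refl (drop≺ 6 2 0ᶻ<1 7≺0 r₃>0)
    5≺3 : 5 ≺ 3
    5≺3 = tie≺ 5 3 ℤ.≤-refl (drop≺ 6 4 0ᶻ<1 7≺0 r₅>0)
    3≺1 : 3 ≺ 1
    3≺1 = tie≺ 3 1 ℤ.≤-refl (tie≺ 4 2 ℤ.≤-refl 5≺3)
    6≺0 : 6 ≺ 0
    6≺0 = drop≺ 6 0 0ᶻ<1 7≺0 r₁>0
    5≺0 : 5 ≺ 0
    5≺0 = drop≺ 5 0 0ᶻ<1 6≺0 r₁>0
    4≺0 : 4 ≺ 0
    4≺0 = tie≺ 4 0 ℤ.≤-refl 5≺1
    3≺0 : 3 ≺ 0
    3≺0 = drop≺ 3 0 0ᶻ<1 4≺0 r₁>0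
    2≺0 : 2 ≺ 0
    2≺0 = tie≺ 2 0 ℤ.≤-refl 3≺1
    1≺0 : 1 ≺ 0
    1≺0 = drop≺ 1 0 0ᶻ<1 2≺0 r₁>0

    aperiodic : AperiodicBlock (digits 0ℤ 1ℤ 0ℤ)
    aperiodic 1 _ _ e = contradiction (e 1) λ ()
    aperiodic 2 _ _ e = contradiction (e 3) λ ()
    aperiodic 3 _ _ e = contradiction (e 1) λ ()
    aperiodic 4 _ _ e = contradiction (e 1) λ ()
    aperiodic 5 _ _ e = contradiction (e 1) λ ()
    aperiodic 6 _ _ e = contradiction (e 1) λ ()
    aperiodic (suc (suc (suc (suc (suc (suc (suc _)))))))
      _ (s≤s (s≤s (s≤s (s≤s (s≤s (s≤s (s≤s ()))))))) _

  sextic₁₁⇒expansion : P ≈ₚ ℤ[x]⇒ℚ[x] (sextic 1ℤ 1ℤ) → SalemParry 1 7 β × SalemWithCofactor cofactor β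
  sextic₁₁⇒expansion P≈L = expansion⇒cofactor {β} {P} salem minP P≈L
    (greedy 1≺0 2≺0 3≺0 4≺0 5≺0 6≺0)
    (digits-preperiod-period 1ℤ 1ℤ 1ℤ aperiodic) refl
    where
    r₈≈r₁ : orbit β (digits 1ℤ 1ℤ 1ℤ) 8 ≈ᵣ orbit β (digits 1ℤ 1ℤ 1ℤ) 1
    r₈≈r₁ = orbit-closes {β} {P} {ℤ[x]⇒ℚ[x] (sextic 1ℤ 1ℤ)} {digits 1ℤ 1ℤ 1ℤ} minP P≈L
      λ n → closing-identity (seq β n) 1ℚ 1ℚ

    open Orbit {β} {1ℤ} {1ℤ} {1ℤ} β>1 (ℤ.<⇒≤ 0ᶻ<1) (ℤ.<⇒≤ 0ᶻ<1) (ℤ.<⇒≤ 0ᶻ<1) r₈≈r₁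

    -- For each i the comparison with place 0 ties until c₇ = 0 meets the digit 1 at place 7 - i.
    6≺0 : 6 ≺ 0
    6≺0 = drop≺ 6 0 0ᶻ<1 7≺0 r₁>0
    5≺0 : 5 ≺ 0
    5≺0 = tie≺ 5 0 ℤ.≤-refl (drop≺ 6 1 0ᶻ<1 7≺0 r₂>0)
    4≺0 : 4 ≺ 0
    4≺0 = tie≺ 4 0 ℤ.≤-refl (tie≺ 5 1 ℤ.≤-refl (drop≺ 6 2 0ᶻ<1 7≺0 r₃>0))
    3≺0 : 3 ≺ 0
    3≺0 = tie≺ 3 0 ℤ.≤-refl (tie≺ 4 1 ℤ.≤-refl (tie≺ 5 2 ℤ.≤-refl (drop≺ 6 3 0ᶻ<1 7≺0 r₄>0)))
    2≺0 : 2 ≺ 0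
    2≺0 = tie≺ 2 0 ℤ.≤-refl (tie≺ 3 1 ℤ.≤-refl (tie≺ 4 2 ℤ.≤-refl
      (tie≺ 5 3 ℤ.≤-refl (drop≺ 6 4 0ᶻ<1 7≺0 r₅>0))))
    1≺0 : 1 ≺ 0
    1≺0 = tie≺ 1 0 ℤ.≤-refl (tie≺ 2 1 ℤ.≤-refl (tie≺ 3 2 ℤ.≤-refl (tie≺ 4 3 ℤ.≤-refl
      (tie≺ 5 4 ℤ.≤-refl (drop≺ 6 5 0ᶻ<1 7≺0 r₆>0)))))

    aperiodic : AperiodicBlock (digits 1ℤ 1ℤ 1ℤ)
    aperiodic 1 _ _ e = contradiction (e 4) λ ()
    aperiodic 2 _ _ e = contradiction (e 3) λ ()
    aperiodic 3 _ _ e = contradiction (e 2) λ ()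
    aperiodic 4 _ _ e = contradiction (e 1) λ ()
    aperiodic 5 _ _ e = contradiction (e 0) λ ()
    aperiodic 6 _ _ e = contradiction (e 0) λ ()
    aperiodic (suc (suc (suc (suc (suc (suc (suc _)))))))
      _ (s≤s (s≤s (s≤s (s≤s (s≤s (s≤s (s≤s ()))))))) _

-- From the expansion to the polynomial

module _ {c c′ : ℕ → ℤ} (c≡c′ : ∀ n → c (suc n) ≡ c′ (suc n)) where

  eventuallyPeriodic-cong : ∀ {m p} → EventuallyPeriodic c m p → EventuallyPeriodic c′ m p
  eventuallyPeriodic-cong {m} {p} ep (suc n) n≥1 =
    trans (sym (c≡c′ (n ℕ.+ m))) (trans (ep (suc n) n≥1) (c≡c′ (n ℕ.+ m ℕ.+ p)))

preperiod-period-unique : ∀ {c c′ m m′ p p′} → (∀ n → c (suc n) ≡ c′ (suc n)) →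
  HasPreperiodAndPeriod c m p → HasPreperiodAndPeriod c′ m′ p′ → m ≡ m′ × p ≡ p′
preperiod-period-unique {c} {c′} {m} {m′} {p} {p′} c≡c′ per per′ =
  ℕ.≤-antisym (proj₁ below) (proj₁ below′) , ℕ.≤-antisym (proj₂ below) (proj₂ below′)
  where
  open HasPreperiodAndPeriod
  below : m ℕ.≤ m′ × p ℕ.≤ p′
  below = least per m′ p′ (p≥1 per′)
    (eventuallyPeriodic-cong {c′} {c} (λ n → sym (c≡c′ n)) (periodic per′))
  below′ : m′ ℕ.≤ m × p′ ℕ.≤ p
  below′ = least per′ m p (p≥1 per) (eventuallyPeriodic-cong {c} {c′} c≡c′ (periodic per))

-- Integer inequalities between the digits

ℤ-linear₁ : ∀ {i j k l} → k ℤ.≤ l → l ℤ.- k ≡ j ℤ.- i → i ℤ.≤ j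
ℤ-linear₁ k≤l eq = ℤ.0≤i-j⇒j≤i (subst (0ℤ ℤ.≤_) eq (ℤ.i≤j⇒0≤j-i k≤l))

ℤ-linear₂ : ∀ {i j k l k′ l′} → k ℤ.≤ l → k′ ℤ.≤ l′ → (l ℤ.- k) ℤ.+ (l′ ℤ.- k′) ≡ j ℤ.- i → i ℤ.≤ j
ℤ-linear₂ k≤l k′≤l′ eq = ℤ.0≤i-j⇒j≤i
  (subst (0ℤ ℤ.≤_) eq (ℤ.+-mono-≤ (ℤ.i≤j⇒0≤j-i k≤l) (ℤ.i≤j⇒0≤j-i k′≤l′)))

0≤i≤1⇒i≡0∨i≡1 : ∀ {i} → 0ℤ ℤ.≤ i → i ℤ.≤ 1ℤ → i ≡ 0ℤ ⊎ i ≡ 1ℤ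
0≤i≤1⇒i≡0∨i≡1 {ℤ.+0} _ _ = inj₁ refl
0≤i≤1⇒i≡0∨i≡1 {ℤ.+[1+ 0 ]} _ _ = inj₂ refl
0≤i≤1⇒i≡0∨i≡1 {ℤ.+[1+ suc _ ]} _ (ℤ.+≤+ (s≤s ()))

-- c₄ + c₃ + 1 = 2 c₁ + c₂ and c₄ ≤ c₁ leave c₃ ∈ {c₁, c₁ - 1}; then the
-- lexicographic conditions at c₃ c₄ and at c₄ c₅ force c₁ = 1.
digit-cases : ∀ {c₁ c₂ c₃ c₄} → 1ℤ ℤ.≤ c₁ → 0ℤ ℤ.≤ c₂ → c₃ ℤ.≤ c₁ → c₄ ℤ.≤ c₁ →
  (c₃ ≡ c₁ → c₄ ℤ.≤ c₂) → (c₄ ≡ c₁ → c₃ ℤ.≤ c₂) →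
  c₄ ≡ c₁ ℤ.+ c₁ ℤ.+ c₂ ℤ.- c₃ ℤ.- 1ℤ →
  c₁ ≡ 1ℤ × ((c₂ ≡ 0ℤ × c₃ ≡ 0ℤ) ⊎ (c₂ ≡ 0ℤ × c₃ ≡ 1ℤ) ⊎ (c₂ ≡ 1ℤ × c₃ ≡ 1ℤ))
digit-cases {c₁} {c₂} {c₃} {c₄} c₁≥1 c₂≥0 c₃≤c₁ c₄≤c₁ lex₃ lex₄ refl with c₃ ℤ.≟ c₁
-- Here c₄ = c₁ + c₂ - 1: the condition c₄ ≤ c₂ gives c₁ ≤ 1, and c₄ ≤ c₁ gives c₂ ≤ 1.
... | yes refl = c₁≡1 , equal (0≤i≤1⇒i≡0∨i≡1 c₂≥0 (ℤ-linear₁ c₄≤c₁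
        (ℤ-solve 2 (λ a b → a :-ᶻ (a :+ᶻ a :+ᶻ b :-ᶻ a :-ᶻ conᶻ 1ℤ) :=ᶻ conᶻ 1ℤ :-ᶻ b) refl c₁ c₂)))
  where
  c₁≡1 : c₁ ≡ 1ℤ
  c₁≡1 = ℤ.≤-antisym (ℤ-linear₁ (lex₃ refl)
    (ℤ-solve 2 (λ a b → b :-ᶻ (a :+ᶻ a :+ᶻ b :-ᶻ a :-ᶻ conᶻ 1ℤ) :=ᶻ conᶻ 1ℤ :-ᶻ a) refl c₁ c₂)) c₁≥1
  equal : c₂ ≡ 0ℤ ⊎ c₂ ≡ 1ℤ → (c₂ ≡ 0ℤ × c₁ ≡ 0ℤ) ⊎ (c₂ ≡ 0ℤ × c₁ ≡ 1ℤ) ⊎ (c₂ ≡ 1ℤ × c₁ ≡ 1ℤ)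
  equal (inj₁ c₂≡0) = inj₂ (inj₁ (c₂≡0 , c₁≡1))
  equal (inj₂ c₂≡1) = inj₂ (inj₂ (c₂≡1 , c₁≡1))
-- Now c₄ ≤ c₁ reads c₁ + c₂ ≤ c₃ + 1 ≤ c₁. This forces c₂ = 0 and c₁ = c₃ + 1, hence c₄ = c₁, and
-- the condition at c₄ c₅ yields c₃ ≤ 0.
... | no c₃≢c₁ = trans c₁≡1+c₃ (cong (λ c → 1ℤ ℤ.+ c) c₃≡0) , inj₁ (c₂≡0 , c₃≡0)
  where
  1+c₃≤c₁ : 1ℤ ℤ.+ c₃ ℤ.≤ c₁
  1+c₃≤c₁ = ℤ.i<j⇒suc[i]≤j (ℤ.≤∧≢⇒< c₃≤c₁ c₃≢c₁)
  c₂≡0 : c₂ ≡ 0ℤ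
  c₂≡0 = ℤ.≤-antisym (ℤ-linear₂ 1+c₃≤c₁ c₄≤c₁
    (ℤ-solve 3 (λ a b c → (a :-ᶻ (conᶻ 1ℤ :+ᶻ c)) :+ᶻ (a :-ᶻ (a :+ᶻ a :+ᶻ b :-ᶻ c :-ᶻ conᶻ 1ℤ)) :=ᶻ conᶻ 0ℤ :-ᶻ b)
      refl c₁ c₂ c₃)) c₂≥0
  c₁≡1+c₃ : c₁ ≡ 1ℤ ℤ.+ c₃
  c₁≡1+c₃ = ℤ.≤-antisym (ℤ-linear₂ c₄≤c₁ c₂≥0
    (ℤ-solve 3 (λ a b c → (a :-ᶻ (a :+ᶻ a :+ᶻ b :-ᶻ c :-ᶻ conᶻ 1ℤ)) :+ᶻ (b :-ᶻ conᶻ 0ℤ) :=ᶻ (conᶻ 1ℤ :+ᶻ c) :-ᶻ a)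
      refl c₁ c₂ c₃)) 1+c₃≤c₁
  c₄≡c₁ : c₁ ℤ.+ c₁ ℤ.+ c₂ ℤ.- c₃ ℤ.- 1ℤ ≡ c₁
  c₄≡c₁ = trans (cong₂ (λ b a → c₁ ℤ.+ a ℤ.+ b ℤ.- c₃ ℤ.- 1ℤ) c₂≡0 c₁≡1+c₃)
    (ℤ-solve 2 (λ a c → a :+ᶻ (conᶻ 1ℤ :+ᶻ c) :+ᶻ conᶻ 0ℤ :-ᶻ c :-ᶻ conᶻ 1ℤ :=ᶻ a) refl c₁ c₃)
  c₃≡0 : c₃ ≡ 0ℤ
  c₃≡0 = ℤ.≤-antisym (subst (c₃ ℤ.≤_) c₂≡0 (lex₄ c₄≡c₁))
    (ℤ-linear₁ (subst (1ℤ ℤ.≤_) c₁≡1+c₃ c₁≥1)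
      (ℤ-solve 1 (λ c → (conᶻ 1ℤ :+ᶻ c) :-ᶻ conᶻ 1ℤ :=ᶻ c :-ᶻ conᶻ 0ℤ) refl c₃))

0≤q×q*q≡1⇒q≡1 : ∀ q → 0ℚ ≤ q → q * q ≡ 1ℚ → q ≡ 1ℚ
0≤q×q*q≡1⇒q≡1 q 0≤q q*q≡1 = trans (solve 1 (λ q → q := q :- con 1ℚ :+ con 1ℚ) refl q)
  (trans (cong (_+ 1ℚ) q-1≡0) (ℚ.+-identityˡ 1ℚ))
  where
  instance
    1+q-positive = ℚ.positive (ℚ.+-mono-<-≤ 0<1 0≤q)
    1+q≠0 = ℚ.pos⇒nonZero (1ℚ + q)
  q-1≡0 : q - 1ℚ ≡ 0ℚ
  q-1≡0 = begin
    q - 1ℚ                                     ≡⟨ ℚ.*-identityˡ (q - 1ℚ) ⟨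
    1ℚ * (q - 1ℚ)                              ≡⟨ cong (_* (q - 1ℚ)) (ℚ.*-inverseˡ (1ℚ + q)) ⟨
    ℚ.1/ (1ℚ + q) * (1ℚ + q) * (q - 1ℚ)        ≡⟨ solve 2 (λ i q → i :* (con 1ℚ :+ q) :* (q :- con 1ℚ)
                                                    := i :* (q :* q :- con 1ℚ)) refl (ℚ.1/ (1ℚ + q)) q ⟩
    ℚ.1/ (1ℚ + q) * (q * q - 1ℚ)               ≡⟨ cong (λ s → ℚ.1/ (1ℚ + q) * (s - 1ℚ)) q*q≡1 ⟩
    ℚ.1/ (1ℚ + q) * (1ℚ - 1ℚ)                  ≡⟨ ℚ.*-zeroʳ (ℚ.1/ (1ℚ + q)) ⟩
    0ℚ                                         ∎
    where open ≡-Reasoning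

expansion⇒sextic : ∀ {β P} → IsSalem β → IsMinimalPolynomial β P → HasDegree P 6 →
  ∀ c {P′} → IsGreedyExpansion β c → IsMinimalPolynomial β P′ →
  ℤ[x]⇒ℚ[x] (companion c 1 7) ≈ₚ P′ *ₚ ℤ[x]⇒ℚ[x] cofactor →
  P ≈ₚ ℤ[x]⇒ℚ[x] (sextic 0ℤ 0ℤ) ⊎ P ≈ₚ ℤ[x]⇒ℚ[x] (sextic 0ℤ 1ℤ) ⊎ P ≈ₚ ℤ[x]⇒ℚ[x] (sextic 1ℤ 1ℤ)
expansion⇒sextic {β} {P} salem minP degP c {P′} greedy minP′ factorisation = conclude
  (digit-cases c₁≥1 c₂≥0 (digit≤c₁ 2) (digit≤c₁ 3) (digit≡c₁⇒next≤c₂ 2)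
    (λ c₄≡c₁ → subst (ℤ._≤ c 2) c₅≡c₃ (digit≡c₁⇒next≤c₂ 3 c₄≡c₁)) c₄-equation)
  where
  open Greedy {β} {c} (IsSalem.β>1 salem) greedy
  open Minimal {β} {P} minP degP using (P≈P̂; leading)
  Q = ℤ[x]⇒ℚ[x] cofactor

  p : ℕ → ℚ
  p = coeff P

  ĉ : ℕ → ℚ
  ĉ n = ℤ⇒ℚ (c n)

  -- Replacing P′ by a list of seven explicit coefficients lets the product with `Q` compute.
  coefficient : ∀ i → coeff (ℤ[x]⇒ℚ[x] (companion c 1 7)) i ≡ coeff (applyUpTo p 7 *ₚ Q) i
  coefficient i = trans (factorisation i)
    (*ₚ-congʳ {P′} {applyUpTo p 7} Q
      (λ j → trans (minimal-unique {β} {P} {P′} minP degP minP′ j) (P≈P̂ j)) i)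

  reciprocal : ∀ i → i ℕ.≤ 6 → coeff P (6 ℕ.∸ i) ≡ p 0 * p i
  reciprocal = salem-reciprocal {β} {P} salem minP degP

  -- Reciprocity at 0 gives p₀² = p₆ = 1. The constant term of P₈ - P₁ is c₁ - c₈, which is
  -- nonnegative because c₁ is the largest digit.
  p₀≡1 : p 0 ≡ 1ℚ
  p₀≡1 = 0≤q×q*q≡1⇒q≡1 (p 0)
    (subst (0ℚ ≤_) p₀-digits (ℤ⇒ℚ-mono-≤ {0ℤ} (ℤ-linear₁ {0ℤ} {0ℤ ℤ.- c 8 ℤ.+ c 1} (digit≤c₁ 7)
      (ℤ-solve 2 (λ a b → a :-ᶻ b :=ᶻ (conᶻ 0ℤ :-ᶻ b :+ᶻ a) :-ᶻ conᶻ 0ℤ) refl (c 1) (c 8)))))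
    (trans (sym (reciprocal 0 z≤n)) leading)
    where
    p₀-digits : ℤ⇒ℚ (0ℤ ℤ.- c 8 ℤ.+ c 1) ≡ p 0
    p₀-digits = trans (cong ℤ⇒ℚ (cong₂ ℤ._+_ (ℤ.+-identityˡ (ℤ.- c 8)) (sym (ℤ.neg-involutive (c 1)))))
      (trans (coefficient 0) (solve 1 (λ p → p :* con 1ℚ :+ con 0ℚ := p) refl (p 0)))

  p₅≡p₁ : p 5 ≡ p 1
  p₅≡p₁ = trans (reciprocal 1 (s≤s z≤n)) (trans (cong (_* p 1) p₀≡1) (ℚ.*-identityˡ (p 1)))

  p₄≡p₂ : p 4 ≡ p 2
  p₄≡p₂ = trans (reciprocal 2 (s≤s (s≤s z≤n))) (trans (cong (_* p 2) p₀≡1) (ℚ.*-identityˡ (p 2)))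

  -- For n ≤ 6 the coefficient of x⁸⁻ⁿ in P₈ - P₁ is -cₙ, as P₁ has degree 1.
  from-negated : ∀ n {q} → ℤ⇒ℚ (ℤ.- c n) ≡ q → ĉ n ≡ - q
  from-negated n {q} eq = trans (solve 1 (λ x → x := :- (:- x)) refl (ĉ n))
    (cong -_ (trans (sym (ℤ⇒ℚ-homo‿- (c n))) eq))

  ĉ₁ : ĉ 1 ≡ - (p 1 * 1ℚ + 1ℚ * - 1ℚ)
  ĉ₁ = trans (from-negated 1 (coefficient 7))
    (cong₂ (λ p₅ p₆ → - (p₅ * 1ℚ + p₆ * - 1ℚ)) p₅≡p₁ leading)

  ĉ₂ : ĉ 2 ≡ - (p 2 * 1ℚ + (p 1 * - 1ℚ + (1ℚ * 1ℚ + 0ℚ)))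
  ĉ₂ = trans (from-negated 2 (coefficient 6)) (trans
    (cong₂ (λ p₄ p₅ → - (p₄ * 1ℚ + (p₅ * - 1ℚ + (p 6 * 1ℚ + 0ℚ)))) p₄≡p₂ p₅≡p₁)
    (cong (λ p₆ → - (p 2 * 1ℚ + (p 1 * - 1ℚ + (p₆ * 1ℚ + 0ℚ)))) leading))

  ĉ₃ : ĉ 3 ≡ - (p 3 * 1ℚ + (p 2 * - 1ℚ + (p 1 * 1ℚ + 0ℚ)))
  ĉ₃ = trans (from-negated 3 (coefficient 5))
    (cong₂ (λ p₄ p₅ → - (p 3 * 1ℚ + (p₄ * - 1ℚ + (p₅ * 1ℚ + 0ℚ)))) p₄≡p₂ p₅≡p₁)

  ĉ₄ : ĉ 4 ≡ - (p 2 * 1ℚ + (p 3 * - 1ℚ + (p 2 * 1ℚ + 0ℚ)))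
  ĉ₄ = trans (from-negated 4 (coefficient 4))
    (cong (λ p₄ → - (p 2 * 1ℚ + (p 3 * - 1ℚ + (p₄ * 1ℚ + 0ℚ)))) p₄≡p₂)

  -- `P` and x² - x + 1 are palindromic, hence so is their product of degree 8, and its coefficients
  -- at 3 and 5 agree.
  c₅≡c₃ : c 5 ≡ c 3
  c₅≡c₃ = ℤ⇒ℚ-injective (trans (from-negated 5 (coefficient 3))
    (trans (solve 3 (λ x y z → :- (x :* con 1ℚ :+ (y :* (:- con 1ℚ) :+ (z :* con 1ℚ :+ con 0ℚ)))
                            := :- (z :* con 1ℚ :+ (y :* (:- con 1ℚ) :+ (x :* con 1ℚ :+ con 0ℚ))))
             refl (p 1) (p 2) (p 3))
      (sym ĉ₃)))

  -- Both sides equal p₃ - 2 p₂: four digits are expressed by the three coefficients p₁, p₂, p₃,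
  -- which leaves one linear relation.
  c₄-equation : c 4 ≡ c 1 ℤ.+ c 1 ℤ.+ c 2 ℤ.- c 3 ℤ.- 1ℤ
  c₄-equation = ℤ⇒ℚ-injective (begin
    ĉ 4
      ≡⟨ ĉ₄ ⟩
    - (p 2 * 1ℚ + (p 3 * - 1ℚ + (p 2 * 1ℚ + 0ℚ)))
      ≡⟨ solve 3 (λ x y z →
              :- (y :* con 1ℚ :+ (z :* (:- con 1ℚ) :+ (y :* con 1ℚ :+ con 0ℚ)))
           := :- (x :* con 1ℚ :+ con 1ℚ :* (:- con 1ℚ)) :+ :- (x :* con 1ℚ :+ con 1ℚ :* (:- con 1ℚ))
              :+ :- (y :* con 1ℚ :+ (x :* (:- con 1ℚ) :+ (con 1ℚ :* con 1ℚ :+ con 0ℚ)))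
              :- :- (z :* con 1ℚ :+ (y :* (:- con 1ℚ) :+ (x :* con 1ℚ :+ con 0ℚ))) :- con 1ℚ)
           refl (p 1) (p 2) (p 3) ⟩
    - (p 1 * 1ℚ + 1ℚ * - 1ℚ) + - (p 1 * 1ℚ + 1ℚ * - 1ℚ)
      + - (p 2 * 1ℚ + (p 1 * - 1ℚ + (1ℚ * 1ℚ + 0ℚ)))
      - - (p 3 * 1ℚ + (p 2 * - 1ℚ + (p 1 * 1ℚ + 0ℚ))) - 1ℚ
      ≡⟨ cong₂ (λ u v → u - v - 1ℚ) (cong₂ (λ x y → x + x + y) (sym ĉ₁) (sym ĉ₂)) (sym ĉ₃) ⟩
    ĉ 1 + ĉ 1 + ĉ 2 - ĉ 3 - 1ℚ
      ≡⟨ cong₂ (λ u v → u + v - 1ℚ)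
           (trans (ℤ⇒ℚ-homo-+ (c 1 ℤ.+ c 1) (c 2)) (cong (_+ ĉ 2) (ℤ⇒ℚ-homo-+ (c 1) (c 1))))
           (ℤ⇒ℚ-homo‿- (c 3)) ⟨
    ℤ⇒ℚ (c 1 ℤ.+ c 1 ℤ.+ c 2) + ℤ⇒ℚ (ℤ.- c 3) - 1ℚ
      ≡⟨ cong (_- 1ℚ) (ℤ⇒ℚ-homo-+ (c 1 ℤ.+ c 1 ℤ.+ c 2) (ℤ.- c 3)) ⟨
    ℤ⇒ℚ (c 1 ℤ.+ c 1 ℤ.+ c 2 ℤ.- c 3) - 1ℚ
      ≡⟨ ℤ⇒ℚ-homo-+ (c 1 ℤ.+ c 1 ℤ.+ c 2 ℤ.- c 3) (ℤ.- 1ℤ) ⟨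
    ℤ⇒ℚ (c 1 ℤ.+ c 1 ℤ.+ c 2 ℤ.- c 3 ℤ.- 1ℤ) ∎)
    where open ≡-Reasoning

  p₁-digits : p 1 ≡ 1ℚ - ĉ 1
  p₁-digits = trans (solve 1 (λ x → x := con 1ℚ :- :- (x :* con 1ℚ :+ con 1ℚ :* (:- con 1ℚ))) refl (p 1))
    (cong (λ x → 1ℚ - x) (sym ĉ₁))

  p₂-digits : p 2 ≡ - ĉ 1 - ĉ 2
  p₂-digits = trans
    (solve 2 (λ x y → y := :- :- (x :* con 1ℚ :+ con 1ℚ :* (:- con 1ℚ))
      :- :- (y :* con 1ℚ :+ (x :* (:- con 1ℚ) :+ (con 1ℚ :* con 1ℚ :+ con 0ℚ)))) refl (p 1) (p 2))
    (cong₂ (λ x y → - x - y) (sym ĉ₁) (sym ĉ₂))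

  p₃-digits : p 3 ≡ - ĉ 2 - 1ℚ - ĉ 3
  p₃-digits = trans
    (solve 3 (λ x y z → z := :- :- (y :* con 1ℚ :+ (x :* (:- con 1ℚ) :+ (con 1ℚ :* con 1ℚ :+ con 0ℚ)))
      :- con 1ℚ :- :- (z :* con 1ℚ :+ (y :* (:- con 1ℚ) :+ (x :* con 1ℚ :+ con 0ℚ)))) refl (p 1) (p 2) (p 3))
    (cong₂ (λ x y → - x - 1ℚ - y) (sym ĉ₂) (sym ĉ₃))

  P≈digits : ∀ {k l m} → c 1 ≡ k → c 2 ≡ l → c 3 ≡ m →
    P ≈ₚ 1ℚ ∷ 1ℚ - ℤ⇒ℚ k ∷ - ℤ⇒ℚ k - ℤ⇒ℚ l ∷ - ℤ⇒ℚ l - 1ℚ - ℤ⇒ℚ m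
              ∷ - ℤ⇒ℚ k - ℤ⇒ℚ l ∷ 1ℚ - ℤ⇒ℚ k ∷ 1ℚ ∷ []
  P≈digits refl refl refl 0 = p₀≡1
  P≈digits refl refl refl 1 = p₁-digits
  P≈digits refl refl refl 2 = p₂-digits
  P≈digits refl refl refl 3 = p₃-digits
  P≈digits refl refl refl 4 = trans p₄≡p₂ p₂-digits
  P≈digits refl refl refl 5 = trans p₅≡p₁ p₁-digits
  P≈digits refl refl refl 6 = leading
  P≈digits refl refl refl (suc (suc (suc (suc (suc (suc (suc i))))))) =
    proj₂ degP (7 ℕ.+ i) (s≤s (s≤s (s≤s (s≤s (s≤s (s≤s (s≤s z≤n)))))))

  conclude : c 1 ≡ 1ℤ × ((c 2 ≡ 0ℤ × c 3 ≡ 0ℤ) ⊎ (c 2 ≡ 0ℤ × c 3 ≡ 1ℤ) ⊎ (c 2 ≡ 1ℤ × c 3 ≡ 1ℤ)) →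
    P ≈ₚ ℤ[x]⇒ℚ[x] (sextic 0ℤ 0ℤ) ⊎ P ≈ₚ ℤ[x]⇒ℚ[x] (sextic 0ℤ 1ℤ) ⊎ P ≈ₚ ℤ[x]⇒ℚ[x] (sextic 1ℤ 1ℤ)
  conclude (c₁≡1 , inj₁ (c₂≡0 , c₃≡0))        = inj₁ (P≈digits c₁≡1 c₂≡0 c₃≡0)
  conclude (c₁≡1 , inj₂ (inj₁ (c₂≡0 , c₃≡1))) = inj₂ (inj₁ (P≈digits c₁≡1 c₂≡0 c₃≡1))
  conclude (c₁≡1 , inj₂ (inj₂ (c₂≡1 , c₃≡1))) = inj₂ (inj₂ (P≈digits c₁≡1 c₂≡1 c₃≡1))

proposition2p4 : (β : ℝ) (P : ℚ[x]) → IsSalem β → IsMinimalPolynomial β P → HasDegree P 6 →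
    (SalemParry 1 7 β × SalemWithCofactor (1ℤ ∷ -1ℤ ∷ 1ℤ ∷ []) β)
    ⇔
    ( P ≈ₚ ℤ[x]⇒ℚ[x] (1ℤ ∷ 0ℤ ∷ -1ℤ ∷ -1ℤ ∷ -1ℤ ∷ 0ℤ ∷ 1ℤ ∷ [])
    ⊎ P ≈ₚ ℤ[x]⇒ℚ[x] (1ℤ ∷ 0ℤ ∷ -1ℤ ∷ -[1+ 1 ] ∷ -1ℤ ∷ 0ℤ ∷ 1ℤ ∷ [])
    ⊎ P ≈ₚ ℤ[x]⇒ℚ[x] (1ℤ ∷ 0ℤ ∷ -[1+ 1 ] ∷ -[1+ 2 ] ∷ -[1+ 1 ] ∷ 0ℤ ∷ 1ℤ ∷ []) )
proposition2p4 β P salem minP degP = mk⇔ to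
  [ sextic₀₀⇒expansion {β} {P} salem minP
  , [ sextic₀₁⇒expansion {β} {P} salem minP , sextic₁₁⇒expansion {β} {P} salem minP ]′ ]′
  where
  Targets : Set
  Targets = P ≈ₚ ℤ[x]⇒ℚ[x] (sextic 0ℤ 0ℤ) ⊎ P ≈ₚ ℤ[x]⇒ℚ[x] (sextic 0ℤ 1ℤ) ⊎ P ≈ₚ ℤ[x]⇒ℚ[x] (sextic 1ℤ 1ℤ)

  -- The preperiod and period supplied with the co-factor are variables here, so that matching on
  -- `refl` can replace them by 1 and 7.
  at-1-7 : ∀ {m p} c P′ → 1 ≡ m × 7 ≡ p → IsGreedyExpansion β c → IsMinimalPolynomial β P′ →
           ℤ[x]⇒ℚ[x] (companion c m p) ≈ₚ P′ *ₚ ℤ[x]⇒ℚ[x] cofactor → Targets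
  at-1-7 c P′ (refl , refl) = expansion⇒sextic {β} {P} salem minP degP c {P′}

  to : SalemParry 1 7 β × SalemWithCofactor cofactor β → Targets
  to ((_ , c₀ , greedy₀ , per₀) , (_ , c , m , p , P′ , greedy , per , minP′ , eq)) =
    at-1-7 c P′
      (preperiod-period-unique {c₀} {c} (greedy-unique {β} {c₀} {c} greedy₀ greedy) per₀ per)
      greedy minP′ eq
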